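{- For all $x_1,x_2\ge 0$ with $x_1+x_2\le 1$, $$C_\infty(x_1,x_2)\le\begin{cases}2.014096 & \text{if } x_1,x_2\le 6/11,\\ 11/12 & \text{otherwise.}\end{cases}$$
   Context: The $k$-simplex is $\{x\in\mathbb{R}^k: x\ge 0,\ \sum_i x_i=1\}$. Let $F(z)=\min\{(11/6)z,1\}$ for $z\in[0,1]$, and let $F'(z)=11/6$ for $z\in[0,6/11]$ and $F'(z)=0$ otherwise. For a point $(x_1,\dots,x_k)$ of the $k$-simplex define $$d_k(x_1,\ldots,x_k)=\frac{1}{k!}\sum_{\sigma}\Big(F'(x_1)\prod_{i:\sigma(i)<\sigma(1)}[1-F(x_i)]+F'(x_2)\prod_{i:\sigma(i)<\sigma(2)}[1-F(x_i)]\Big),$$ the sum being over all permutations $\sigma$ of $\{1,\dots,k\}$. For $k\ge 3$ and $x_1,x_2\ge0$ with $x_1+x_2\le1$ define $C_k(x_1,x_2)=d_k(x_1,x_2,c,\ldots,c)$ where $c=(1-x_1-x_2)/(k-2)$, and $C_\infty(x_1,x_2)=\lim_{k\to\infty}C_k(x_1,x_2)$ (this limit exists, since for $k\ge4$ the sequence is nondecreasing in $k$ and it is bounded). -}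

module Defs where

open import Level using (0ℓ)
open import Algebra.Bundles using (CommutativeRing)
import Algebra.Construct.NaturalChoice.Max as Max
import Algebra.Construct.NaturalChoice.Min as Min
open import Data.Bool.Base using (if_then_else_)
open import Data.Fin.Base using (Fin; zero; suc; punchIn)
open import Data.Fin.Patterns using (0F; 1F)
import Data.Fin.Properties as Fin
open import Data.Fin.Permutation as Perm using (Permutation′; _⟨$⟩ʳ_; insert; remove)
open import Data.List.Base using (List; []; _∷_; allFin; cartesianProductWith; filter; foldr; map)
open import Data.List.Membership.Propositional.Properties using (∈-allFin)
import Data.List.Membership.Setoid as Membership
import Data.List.Membership.Setoid.Properties as Membershipₚ
open import Data.List.Relation.Unary.Any using (here)
open import Data.List.Relation.Unary.All using ([])
open import Data.List.Relation.Unary.AllPairs using ([]; _∷_)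
import Data.List.Relation.Unary.Unique.Setoid as Unique
import Data.List.Relation.Unary.Unique.Setoid.Properties as Uniqueₚ
import Data.List.Relation.Unary.Unique.Propositional.Properties as Unique≡ₚ
open import Data.Nat.Base using (ℕ; zero; suc; _!) renaming (_+_ to _+ᴺ_; _≤_ to _≤ᴺ_)
open import Data.Product.Base using (∃; _×_; _,_)
open import Data.Vec.Functional using (Vector; replicate) renaming (_∷_ to _∷ᵛ_)
import Algebra.Definitions.RawMonoid as RawMonoid
open import Relation.Binary.Bundles using (DecTotalOrder; Setoid)
open import Relation.Binary.Core using (Rel)
import Relation.Binary.Construct.NonStrictToStrict as ToStrict
open import Relation.Binary.PropositionalEquality as ≡ using (_≡_)
open import Relation.Binary.Structures using (IsDecTotalOrder)
open import Relation.Nullary using (¬_; does)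

-- The real numbers are given axiomatically, as a complete ordered field (unique up to
-- isomorphism).  The order is decidable, as it is for the classical reals: F′ below is
-- discontinuous, so it is defined by cases on the order.
record CompleteOrderedField : Set₁ where
  infix  8 _⁻¹
  infix  4 _≤_
  field
    commutativeRing : CommutativeRing 0ℓ 0ℓ

  open CommutativeRing commutativeRing public

  field
    _≤_             : Rel Carrier 0ℓ
    isDecTotalOrder : IsDecTotalOrder _≈_ _≤_
    0≉1             : ¬ 0# ≈ 1#
    -- total, but unspecified at 0
    _⁻¹             : Carrier → Carrier
    ⁻¹-inverseʳ     : ∀ x → ¬ x ≈ 0# → x * x ⁻¹ ≈ 1#
    +-monoʳ-≤       : ∀ z {x y} → x ≤ y → z + x ≤ z + y
    *-nonNegative   : ∀ {x y} → 0# ≤ x → 0# ≤ y → 0# ≤ x * y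

  UpperBound : (Carrier → Set) → Carrier → Set
  UpperBound P b = ∀ x → P x → x ≤ b

  field
    supremum : (P : Carrier → Set) → ∃ P → ∃ (UpperBound P) →
               ∃ λ s → UpperBound P s × (∀ b → UpperBound P b → s ≤ b)

  decTotalOrder : DecTotalOrder 0ℓ 0ℓ 0ℓ
  decTotalOrder = record { isDecTotalOrder = isDecTotalOrder }

  open DecTotalOrder decTotalOrder public using (_≤?_; totalOrder)
  open ToStrict _≈_ _≤_ public using (_<_)
  open Min totalOrder public using (_⊓_)
  open Max totalOrder public using (_⊔_)

-- insert 0F j π sends 0F to j and the remaining indices to the remaining values in the
-- order prescribed by π; the two lemmas below show that every permutation is listed
-- exactly once.
permutations : ∀ n → List (Permutation′ n)
permutations zero    = Perm.id ∷ []
permutations (suc n) = cartesianProductWith (insert 0F) (allFin (suc n)) (permutations n)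

permutationSetoid : ℕ → Setoid 0ℓ 0ℓ
permutationSetoid n = record
  { Carrier       = Permutation′ n
  ; _≈_           = Perm._≈_
  ; isEquivalence = record
    { refl  = λ _ → ≡.refl
    ; sym   = λ p i → ≡.sym (p i)
    ; trans = λ p q i → ≡.trans (p i) (q i)
    }
  }

insert-cong : ∀ {n} {j k : Fin (suc n)} {π ρ : Permutation′ n} → j ≡ k → π Perm.≈ ρ →
              insert 0F j π Perm.≈ insert 0F k ρ
insert-cong         j≡k π≈ρ zero    = j≡k
insert-cong {j = j} {π = π} {ρ} ≡.refl π≈ρ (suc i) =
  ≡.trans (Perm.insert-punchIn 0F j π i)
    (≡.trans (≡.cong (punchIn j) (π≈ρ i)) (≡.sym (Perm.insert-punchIn 0F j ρ i)))

insert-injective : ∀ {n} {j k : Fin (suc n)} {π ρ : Permutation′ n} →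
                   insert 0F j π Perm.≈ insert 0F k ρ → j ≡ k × π Perm.≈ ρ
insert-injective {j = j} {π = π} {ρ} eq with ≡.refl ← eq 0F =
  ≡.refl , λ i → Fin.punchIn-injective j _ _
    (≡.trans (≡.sym (Perm.insert-punchIn 0F j π i))
      (≡.trans (eq (suc i)) (Perm.insert-punchIn 0F j ρ i)))

permutations-complete : ∀ n (π : Permutation′ n) →
                        Membership._∈_ (permutationSetoid n) π (permutations n)
permutations-complete zero    π = here λ ()
permutations-complete (suc n) π =
  Membershipₚ.∈-resp-≈ (permutationSetoid (suc n))
    {x = insert 0F (π ⟨$⟩ʳ 0F) (remove 0F π)} {y = π} (Perm.insert-remove 0F π)
    (Membershipₚ.∈-cartesianProductWith⁺
      (≡.setoid _) (permutationSetoid n) (permutationSetoid (suc n))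
      {f = insert 0F} (λ {j} {k} {π} {ρ} → insert-cong {j = j} {k} {π} {ρ})
      (∈-allFin (π ⟨$⟩ʳ 0F)) (permutations-complete n (remove 0F π)))

permutations-unique : ∀ n → Unique.Unique (permutationSetoid n) (permutations n)
permutations-unique zero    = [] ∷ []
permutations-unique (suc n) =
  Uniqueₚ.cartesianProductWith⁺
    (≡.setoid _) (permutationSetoid n) (permutationSetoid (suc n))
    (insert 0F) (λ {j} {k} {π} {ρ} → insert-injective {j = j} {k} {π} {ρ})
    (Unique≡ₚ.allFin⁺ (suc n)) (permutations-unique n)

module Simplex (ℝ : CompleteOrderedField) where

  open CompleteOrderedField ℝ
  open RawMonoid +-rawMonoid using () renaming (_×_ to _·_)

  -- Opaque so that large literals are never unfolded in unary; fromℕ-def characterises it.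
  opaque
    fromℕ : ℕ → Carrier
    fromℕ n = n · 1#

    fromℕ-def : ∀ n → fromℕ n ≡ n · 1#
    fromℕ-def n = ≡.refl

  infixl 7 _/_
  _/_ : ℕ → ℕ → Carrier
  m / n = fromℕ m * fromℕ n ⁻¹

  ∑ : ∀ {A : Set} → List A → (A → Carrier) → Carrier
  ∑ as f = foldr _+_ 0# (map f as)

  ∏ : ∀ {A : Set} → List A → (A → Carrier) → Carrier
  ∏ as f = foldr _*_ 1# (map f as)

  ∣_∣ : Carrier → Carrier
  ∣ x ∣ = x ⊔ (- x)

  infix 4 _⟶_
  _⟶_ : (ℕ → Carrier) → Carrier → Set
  s ⟶ l = ∀ ε → 0# < ε → ∃ λ N → ∀ n → N ≤ᴺ n → ∣ s n - l ∣ < ε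

  F : Carrier → Carrier
  F z = (11 / 6 * z) ⊓ 1#

  F′ : Carrier → Carrier
  F′ z = if does (z ≤? 6 / 11) then 11 / 6 else 0#

  before : ∀ {k} → Permutation′ k → Fin k → List (Fin k)
  before {k} σ j = filter (λ i → (σ ⟨$⟩ʳ i) Fin.<? (σ ⟨$⟩ʳ j)) (allFin k)

  -- The dimension is k = 2 + n; the coordinates x₁ and x₂ are x 0F and x 1F.
  d : ∀ {n} → Vector Carrier (2 +ᴺ n) → Carrier
  d {n} x = fromℕ ((2 +ᴺ n) !) ⁻¹ * ∑ (permutations (2 +ᴺ n)) λ σ →
    F′ (x 0F) * ∏ (before σ 0F) (λ i → 1# - F (x i)) +
    F′ (x 1F) * ∏ (before σ 1F) (λ i → 1# - F (x i))

  -- C m is C_k for k = 3 + m, so that k - 2 = suc m is never zero.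
  C : ℕ → Carrier → Carrier → Carrier
  C m x₁ x₂ = d (x₁ ∷ᵛ x₂ ∷ᵛ replicate (suc m) c)
    where
    c : Carrier
    c = (1# - x₁ - x₂) * fromℕ (suc m) ⁻¹

{-# OPTIONS --safe #-}

module Submission where

-- Placing x₁ and x₂ first and the equal coordinates c in any order, the sum over all
-- permutations collapses to an explicit single sum over positions.  If x₁ > 6/11 then
-- F′ x₁ = 0 and 1 - F x₁ = 0, and what remains is at most 11/6 times the mean of 1 - τ over
-- [0, 1].  Otherwise 1 - F c = 1 - a/M, where M = k - 2 is the number of coordinates c and
-- a = (11/6) (1 - x₁ - x₂), and the sum tends to
--
--   (11/6) ∫₀¹ (2 - (11/6) (x₁ + x₂) τ) e^(-a τ) dτ,
--
-- a function of t = x₁ + x₂ alone.  Instead of exponentials and integrals, the Bonferroni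
-- inequalities bound (1 - a/M)^l by the first seven terms of its binomial expansion, which
-- are summed in closed form.  Up to an error O(1/M) this replaces e^(-a τ) by its Taylor
-- polynomial of degree 6, and leaves a polynomial inequality in t ∈ [0, 1].

open import Defs
import Algebra.Construct.NaturalChoice.Max as Max
import Algebra.Construct.NaturalChoice.Min as Min
import Algebra.Properties.CommutativeSemiring.Exp
import Algebra.Properties.Monoid.Mult
import Algebra.Properties.Ring
import Algebra.Properties.Semiring.Exp
import Algebra.Properties.Semiring.Mult
import Algebra.Solver.Ring
open import Algebra.Solver.Ring.AlmostCommutativeRing
  using (AlmostCommutativeRing; _-Raw-AlmostCommutative⟶_; fromCommutativeRing; Induced-equivalence)
open import Data.Bool.Base using (Bool; true; false; if_then_else_)
open import Data.Fin.Base using (Fin; zero; suc; toℕ; punchIn)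
open import Data.Fin.Patterns using (0F; 1F)
open import Data.Fin.Permutation
  using (Permutation′; _⟨$⟩ʳ_; insert; remove; insert-punchIn; punchIn-permute)
import Data.Fin.Properties as Fin
open import Data.Integer.Base as ℤ using (ℤ; +_; -[1+_]; _⊖_)
import Data.Integer.Properties as ℤ
open import Data.List.Base
  using (List; []; _∷_; _++_; allFin; cartesianProductWith; filter; foldr; length; map; tabulate)
import Data.List.Properties as List
open import Data.Maybe.Base using (just; nothing)
open import Data.Nat.Base as ℕ using (ℕ; zero; suc; pred; _!)
open import Data.Nat.Combinatorics using (k>n⇒nCk≡0; nCk+nC[k+1]≡[n+1]C[k+1]) renaming (_C_ to _choose_)
import Data.Nat.Properties as ℕ
open import Data.Product.Base using (∃; _×_; _,_; proj₁; proj₂)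
open import Data.Sum.Base using (_⊎_; inj₁; inj₂)
open import Data.Vec.Functional using (Vector; replicate) renaming (_∷_ to _∷ᵛ_)
open import Function.Base using (_∘_; _$_; id)
open import Relation.Binary.Bundles using (DecTotalOrder)
open import Relation.Binary.Definitions using (WeaklyDecidable)
open import Relation.Binary.PropositionalEquality as ≡ using (_≡_; _≗_)
import Relation.Binary.Reasoning.PartialOrder
open import Relation.Nullary using (¬_; Dec; yes; no; does; contradiction; Reflects; ofʸ; ofⁿ)
open import Relation.Nullary.Decidable using (_×-dec_)
open import Relation.Unary using (Decidable; _≐_)

private variable
  A B : Set
  n : ℕ

≡-if : {P : Set} {b : Bool} {x y z : A} → Reflects P b →
       (P → x ≡ y) → (¬ P → x ≡ z) → x ≡ (if b then y else z)
≡-if (ofʸ p)  x≡y x≡z = x≡y p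
≡-if (ofⁿ ¬p) x≡y x≡z = x≡z ¬p

punchIn-≤ : (j : Fin (suc n)) (l : Fin n) → toℕ j ℕ.≤ toℕ l → toℕ (punchIn j l) ≡ suc (toℕ l)
punchIn-≤ zero    l       _           = ≡.refl
punchIn-≤ (suc j) (suc l) (ℕ.s≤s j≤l) = ≡.cong suc (punchIn-≤ j l j≤l)

punchIn-> : (j : Fin (suc n)) (l : Fin n) → toℕ l ℕ.< toℕ j → toℕ (punchIn j l) ≡ toℕ l
punchIn-> (suc j) zero    _           = ≡.refl
punchIn-> (suc j) (suc l) (ℕ.s≤s l<j) = ≡.cong suc (punchIn-> j l l<j)

filter-map : ∀ {P : B → Set} (P? : Decidable P) (f : A → B) →
             filter P? ∘ map f ≗ map f ∘ filter (P? ∘ f)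
filter-map P? f []       = ≡.refl
filter-map P? f (x ∷ xs) with does (P? (f x))
... | true  = ≡.cong (f x ∷_) (filter-map P? f xs)
... | false = filter-map P? f xs

length-permutations : ∀ n → length (permutations n) ≡ n !
length-permutations zero    = ≡.refl
length-permutations (suc n) = ≡.trans (length-product (allFin (suc n)))
  (≡.cong₂ ℕ._*_ (List.length-tabulate {n = suc n} id) (length-permutations n))
  where
  length-product : ∀ js → length (cartesianProductWith (insert 0F) js (permutations n)) ≡
                          length js ℕ.* length (permutations n)
  length-product []       = ≡.refl
  length-product (j ∷ js) = ≡.trans (List.length-++ (map (insert 0F j) (permutations n)))
    (≡.cong₂ ℕ._+_ (List.length-map (insert 0F j) (permutations n)) (length-product js))

below : (Fin n → ℕ) → ℕ → List (Fin n)
below {n} f p = filter (λ i → f i ℕ.<? p) (allFin n)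

below-tail : {f : Fin (suc n) → ℕ} {f′ : Fin n → ℕ} {p p′ : ℕ} →
             (λ i → f (suc i) ℕ.< p) ≐ (λ i → f′ i ℕ.< p′) →
             filter (λ i → f i ℕ.<? p) (tabulate suc) ≡ map suc (below f′ p′)
below-tail {n} {f} {f′} {p} {p′} f≐f′ = begin
  filter P? (tabulate suc)              ≡⟨ ≡.cong (filter P?) (List.map-tabulate id suc) ⟨
  filter P? (map suc (allFin n))        ≡⟨ filter-map P? suc (allFin n) ⟩
  map suc (filter (P? ∘ suc) (allFin n))
    ≡⟨ ≡.cong (map suc) (List.filter-≐ _ (λ i → f′ i ℕ.<? p′) f≐f′ (allFin n)) ⟩
  map suc (below f′ p′)                 ∎
  where
  open ≡.≡-Reasoning
  P? : Decidable λ i → f i ℕ.< p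
  P? i = f i ℕ.<? p

module _ {l : Fin (suc n)} {f : Fin n → Fin n} {h : Fin n → ℕ} {p : ℕ}
         (h≗ : ∀ i → h i ≡ toℕ (punchIn l (f i))) where

  private
    h≡1+f : ∀ i → toℕ l ℕ.≤ toℕ (f i) → h i ≡ suc (toℕ (f i))
    h≡1+f i l≤fi = ≡.trans (h≗ i) (punchIn-≤ l (f i) l≤fi)

    h≡f : ∀ i → toℕ (f i) ℕ.< toℕ l → h i ≡ toℕ (f i)
    h≡f i fi<l = ≡.trans (h≗ i) (punchIn-> l (f i) fi<l)

  punchIn-below-≤ : toℕ l ℕ.≤ p → (λ i → h i ℕ.< suc p) ≐ (λ i → toℕ (f i) ℕ.< p)
  punchIn-below-≤ l≤p = (λ {i} → to i) , λ {i} → from i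
    where
    to : ∀ i → h i ℕ.< suc p → toℕ (f i) ℕ.< p
    to i hi<1+p with ℕ.≤-<-connex (toℕ l) (toℕ (f i))
    ... | inj₁ l≤fi = ℕ.s<s⁻¹ (≡.subst (ℕ._< suc p) (h≡1+f i l≤fi) hi<1+p)
    ... | inj₂ fi<l = ℕ.<-≤-trans fi<l l≤p
    from : ∀ i → toℕ (f i) ℕ.< p → h i ℕ.< suc p
    from i fi<p with ℕ.≤-<-connex (toℕ l) (toℕ (f i))
    ... | inj₁ l≤fi = ≡.subst (ℕ._< suc p) (≡.sym (h≡1+f i l≤fi)) (ℕ.s<s fi<p)
    ... | inj₂ fi<l = ≡.subst (ℕ._< suc p) (≡.sym (h≡f i fi<l)) (ℕ.m<n⇒m<1+n fi<p)

  punchIn-below-≥ : p ℕ.≤ toℕ l → (λ i → h i ℕ.< p) ≐ (λ i → toℕ (f i) ℕ.< p)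
  punchIn-below-≥ p≤l = (λ {i} → to i) , λ {i} → from i
    where
    to : ∀ i → h i ℕ.< p → toℕ (f i) ℕ.< p
    to i hi<p with ℕ.≤-<-connex (toℕ l) (toℕ (f i))
    ... | inj₁ l≤fi = ℕ.<⇒≤ (≡.subst (ℕ._< p) (h≡1+f i l≤fi) hi<p)
    ... | inj₂ fi<l = ≡.subst (ℕ._< p) (h≡f i fi<l) hi<p
    from : ∀ i → toℕ (f i) ℕ.< p → h i ℕ.< p
    from i fi<p = ≡.subst (ℕ._< p) (≡.sym (h≡f i (ℕ.<-≤-trans fi<p p≤l))) fi<p

module OrderedField (ℝ : CompleteOrderedField) where
  open CompleteOrderedField ℝ
  open Simplex ℝ
  open Algebra.Properties.Ring ring
  open Algebra.Properties.Monoid.Mult +-monoid using (×-homo-+)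
  open Algebra.Properties.Semiring.Mult semiring using (×1-homo-*)
  open Max totalOrder using (x≤y⊔x)
  module ≤ = DecTotalOrder decTotalOrder
  open Relation.Binary.Reasoning.PartialOrder ≤.poset public

  opaque
    unfolding fromℕ

    fromℕ-0 : fromℕ 0 ≈ 0#
    fromℕ-0 = refl

    fromℕ-1 : fromℕ 1 ≈ 1#
    fromℕ-1 = +-identityʳ 1#

    fromℕ-suc : ∀ n → fromℕ (suc n) ≈ 1# + fromℕ n
    fromℕ-suc n = refl

    fromℕ-2+ : ∀ n → fromℕ (2 ℕ.+ n) ≈ 1# + (1# + fromℕ n)
    fromℕ-2+ n = refl

    fromℕ-+ : ∀ m n → fromℕ (m ℕ.+ n) ≈ fromℕ m + fromℕ n
    fromℕ-+ m n = ×-homo-+ 1# m n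

    fromℕ-* : ∀ m n → fromℕ (m ℕ.* n) ≈ fromℕ m * fromℕ n
    fromℕ-* m n = ×1-homo-* m n

  -- 0# and 1# are the images of 0 and 1 on the nose, so that the solver recognises them.
  fromℤ : ℤ → Carrier
  fromℤ (+ 0)           = 0#
  fromℤ (+ 1)           = 1#
  fromℤ (+ suc (suc n)) = fromℕ (suc (suc n))
  fromℤ -[1+ n ]        = - fromℕ (suc n)

  fromℤ-pos : ∀ n → fromℤ (+ n) ≈ fromℕ n
  fromℤ-pos 0 = sym fromℕ-0
  fromℤ-pos 1 = sym fromℕ-1
  fromℤ-pos (suc (suc n)) = refl

  fromℤ-⊖ : ∀ m n → fromℤ (m ⊖ n) ≈ fromℕ m - fromℕ n
  fromℤ-⊖ m zero = begin-equality
    fromℤ (m ⊖ 0)      ≡⟨⟩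
    fromℤ (+ m)        ≈⟨ fromℤ-pos m ⟩
    fromℕ m            ≈⟨ +-identityʳ _ ⟨
    fromℕ m + 0#       ≈⟨ +-congˡ (trans (-‿cong fromℕ-0) -0#≈0#) ⟨
    fromℕ m - fromℕ 0  ∎
  fromℤ-⊖ zero (suc n) = begin-equality
    - fromℕ (suc n)            ≈⟨ +-identityˡ _ ⟨
    0# - fromℕ (suc n)         ≈⟨ +-congʳ fromℕ-0 ⟨
    fromℕ 0 - fromℕ (suc n)    ∎
  fromℤ-⊖ (suc m) (suc n) = begin-equality
    fromℤ (suc m ⊖ suc n)                 ≡⟨ ≡.cong fromℤ (ℤ.[1+m]⊖[1+n]≡m⊖n m n) ⟩
    fromℤ (m ⊖ n)                         ≈⟨ fromℤ-⊖ m n ⟩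
    fromℕ m - fromℕ n                     ≈⟨ +-congʳ (xyx⁻¹≈y 1# (fromℕ m)) ⟨
    1# + fromℕ m - 1# - fromℕ n           ≈⟨ +-assoc _ _ _ ⟩
    1# + fromℕ m + (- 1# - fromℕ n)       ≈⟨ +-congˡ (-‿+-comm 1# (fromℕ n)) ⟩
    1# + fromℕ m - (1# + fromℕ n)         ≈⟨ +-cong (fromℕ-suc m) (-‿cong (fromℕ-suc n)) ⟨
    fromℕ (suc m) - fromℕ (suc n)         ∎

  fromℤ-neg : ∀ i → fromℤ (ℤ.- i) ≈ - fromℤ i
  fromℤ-neg (+ 0) = sym -0#≈0#
  fromℤ-neg (+ 1) = -‿cong fromℕ-1
  fromℤ-neg (+ suc (suc n)) = refl
  fromℤ-neg -[1+ n ] = trans (fromℤ-pos (suc n)) (sym (-‿involutive _))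

  fromℤ-homo-+ : ∀ i j → fromℤ (i ℤ.+ j) ≈ fromℤ i + fromℤ j
  fromℤ-homo-+ (+ m) (+ n) = begin-equality
    fromℤ (+ (m ℕ.+ n))       ≈⟨ fromℤ-pos (m ℕ.+ n) ⟩
    fromℕ (m ℕ.+ n)           ≈⟨ fromℕ-+ m n ⟩
    fromℕ m + fromℕ n         ≈⟨ +-cong (fromℤ-pos m) (fromℤ-pos n) ⟨
    fromℤ (+ m) + fromℤ (+ n) ∎
  fromℤ-homo-+ (+ m) -[1+ n ] = trans (fromℤ-⊖ m (suc n)) (+-congʳ (sym (fromℤ-pos m)))
  fromℤ-homo-+ -[1+ m ] (+ n) =
    trans (fromℤ-⊖ n (suc m)) (trans (+-comm _ _) (+-congˡ (sym (fromℤ-pos n))))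
  fromℤ-homo-+ -[1+ m ] -[1+ n ] = begin-equality
    - fromℕ (suc (suc (m ℕ.+ n)))       ≡⟨ ≡.cong (λ k → - fromℕ (suc k)) (ℕ.+-suc m n) ⟨
    - fromℕ (suc m ℕ.+ suc n)           ≈⟨ -‿cong (fromℕ-+ (suc m) (suc n)) ⟩
    - (fromℕ (suc m) + fromℕ (suc n))   ≈⟨ -‿+-comm _ _ ⟨
    - fromℕ (suc m) - fromℕ (suc n)     ∎

  fromℤ-homo-*⁺ : ∀ m n → fromℤ (+ m ℤ.* + n) ≈ fromℤ (+ m) * fromℤ (+ n)
  fromℤ-homo-*⁺ m n = begin-equality
    fromℤ (+ m ℤ.* + n)       ≡⟨ ≡.cong fromℤ (ℤ.pos-* m n) ⟨
    fromℤ (+ (m ℕ.* n))       ≈⟨ fromℤ-pos (m ℕ.* n) ⟩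
    fromℕ (m ℕ.* n)           ≈⟨ fromℕ-* m n ⟩
    fromℕ m * fromℕ n         ≈⟨ *-cong (fromℤ-pos m) (fromℤ-pos n) ⟨
    fromℤ (+ m) * fromℤ (+ n) ∎

  fromℤ-homo-*ʳ : ∀ m j → fromℤ (+ m ℤ.* j) ≈ fromℤ (+ m) * fromℤ j
  fromℤ-homo-*ʳ m (+ n) = fromℤ-homo-*⁺ m n
  fromℤ-homo-*ʳ m j@(-[1+ n ]) = begin-equality
    fromℤ (+ m ℤ.* j)                   ≡⟨ ≡.cong fromℤ (ℤ.neg-distribʳ-* (+ m) (+ suc n)) ⟨
    fromℤ (ℤ.- (+ m ℤ.* + suc n))       ≈⟨ fromℤ-neg (+ m ℤ.* + suc n) ⟩
    - fromℤ (+ m ℤ.* + suc n)           ≈⟨ -‿cong (fromℤ-homo-*⁺ m (suc n)) ⟩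
    - (fromℤ (+ m) * fromℤ (+ suc n))   ≈⟨ -‿distribʳ-* _ _ ⟩
    fromℤ (+ m) * - fromℤ (+ suc n)     ≈⟨ *-congˡ (fromℤ-neg (+ suc n)) ⟨
    fromℤ (+ m) * fromℤ j               ∎

  fromℤ-homo-* : ∀ i j → fromℤ (i ℤ.* j) ≈ fromℤ i * fromℤ j
  fromℤ-homo-* (+ m) j = fromℤ-homo-*ʳ m j
  fromℤ-homo-* i@(-[1+ m ]) j = begin-equality
    fromℤ (i ℤ.* j)                     ≡⟨ ≡.cong fromℤ (ℤ.neg-distribˡ-* (+ suc m) j) ⟨
    fromℤ (ℤ.- (+ suc m ℤ.* j))         ≈⟨ fromℤ-neg (+ suc m ℤ.* j) ⟩
    - fromℤ (+ suc m ℤ.* j)             ≈⟨ -‿cong (fromℤ-homo-*ʳ (suc m) j) ⟩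
    - (fromℤ (+ suc m) * fromℤ j)       ≈⟨ -‿distribˡ-* _ _ ⟩
    - fromℤ (+ suc m) * fromℤ j         ≈⟨ *-congʳ (fromℤ-neg (+ suc m)) ⟨
    fromℤ i * fromℤ j                   ∎

  private
    acr : AlmostCommutativeRing _ _
    acr = fromCommutativeRing commutativeRing

    fromℤ-morphism : ℤ.+-*-rawRing -Raw-AlmostCommutative⟶ acr
    fromℤ-morphism = record
      { ⟦_⟧    = fromℤ
      ; +-homo = fromℤ-homo-+
      ; *-homo = fromℤ-homo-*
      ; -‿homo = fromℤ-neg
      ; 0-homo = refl
      ; 1-homo = refl
      }

    _≟ᶜ_ : WeaklyDecidable (Induced-equivalence fromℤ-morphism)
    i ≟ᶜ j with i ℤ.≟ j
    ... | yes i≡j = just (reflexive (≡.cong fromℤ i≡j))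
    ... | no  _   = nothing

  open Algebra.Solver.Ring ℤ.+-*-rawRing acr fromℤ-morphism _≟ᶜ_ public
    using (solve; con; _:+_; _:-_; _:*_; _:=_; :-_; _:^_; Polynomial)

  # : ∀ {n} → ℕ → Polynomial n
  # k = con (+ k)

  +-mono-≤ : ∀ {x y u v} → x ≤ y → u ≤ v → x + u ≤ y + v
  +-mono-≤ {x} {y} {u} {v} x≤y u≤v = begin
    x + u ≤⟨ +-monoʳ-≤ x u≤v ⟩
    x + v ≈⟨ +-comm x v ⟩
    v + x ≤⟨ +-monoʳ-≤ v x≤y ⟩
    v + y ≈⟨ +-comm v y ⟩
    y + v ∎

  x≤y⇒0≤y-x : ∀ {x y} → x ≤ y → 0# ≤ y - x
  x≤y⇒0≤y-x {x} {y} x≤y = begin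
    0#      ≈⟨ -‿inverseˡ x ⟨
    - x + x ≤⟨ +-monoʳ-≤ (- x) x≤y ⟩
    - x + y ≈⟨ +-comm (- x) y ⟩
    y - x   ∎

  0≤y-x⇒x≤y : ∀ {x y} → 0# ≤ y - x → x ≤ y
  0≤y-x⇒x≤y {x} {y} 0≤y-x = begin
    x           ≈⟨ +-identityʳ x ⟨
    x + 0#      ≤⟨ +-monoʳ-≤ x 0≤y-x ⟩
    x + (y - x) ≈⟨ solve 2 (λ x y → x :+ (y :- x) := y) refl x y ⟩
    y           ∎

  -‿anti-≤ : ∀ {x y} → x ≤ y → - y ≤ - x
  -‿anti-≤ {x} {y} x≤y = 0≤y-x⇒x≤y $ begin
    0#        ≤⟨ x≤y⇒0≤y-x x≤y ⟩
    y - x     ≈⟨ solve 2 (λ x y → y :- x := :- x :- :- y) refl x y ⟩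
    - x - - y ∎

  *-monoˡ-≤ : ∀ {z x y} → 0# ≤ z → x ≤ y → z * x ≤ z * y
  *-monoˡ-≤ {z} {x} {y} 0≤z x≤y = 0≤y-x⇒x≤y $ begin
    0#            ≤⟨ *-nonNegative 0≤z (x≤y⇒0≤y-x x≤y) ⟩
    z * (y - x)   ≈⟨ x[y-z]≈xy-xz z y x ⟩
    z * y - z * x ∎

  *-monoʳ-≤ : ∀ {z x y} → 0# ≤ z → x ≤ y → x * z ≤ y * z
  *-monoʳ-≤ {z} {x} {y} 0≤z x≤y = begin
    x * z ≈⟨ *-comm x z ⟩
    z * x ≤⟨ *-monoˡ-≤ 0≤z x≤y ⟩
    z * y ≈⟨ *-comm z y ⟩
    y * z ∎

  +-nonNegative : ∀ {x y} → 0# ≤ x → 0# ≤ y → 0# ≤ x + y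
  +-nonNegative 0≤x 0≤y = ≤.trans (≤.reflexive (sym (+-identityʳ 0#))) (+-mono-≤ 0≤x 0≤y)

  *-selfNonNegative : ∀ x → 0# ≤ x * x
  *-selfNonNegative x with ≤.total 0# x
  ... | inj₁ 0≤x = *-nonNegative 0≤x 0≤x
  ... | inj₂ x≤0 = begin
    0#          ≤⟨ *-nonNegative 0≤-x 0≤-x ⟩
    - x * - x   ≈⟨ solve 1 (λ x → :- x :* :- x := x :* x) refl x ⟩
    x * x       ∎
    where
    0≤-x : 0# ≤ - x
    0≤-x = ≤.trans (≤.reflexive (sym -0#≈0#)) (-‿anti-≤ x≤0)

  0≤1 : 0# ≤ 1#
  0≤1 = ≤.trans (*-selfNonNegative 1#) (≤.reflexive (*-identityʳ 1#))

  0≤fromℕ : ∀ n → 0# ≤ fromℕ n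
  0≤fromℕ zero    = ≤.reflexive (sym fromℕ-0)
  0≤fromℕ (suc n) = ≤.trans (+-nonNegative 0≤1 (0≤fromℕ n)) (≤.reflexive (sym (fromℕ-suc n)))

  fromℕ-mono : ∀ {m n} → m ℕ.≤ n → fromℕ m ≤ fromℕ n
  fromℕ-mono {n = n} ℕ.z≤n = ≤.trans (≤.reflexive fromℕ-0) (0≤fromℕ n)
  fromℕ-mono {suc m} {suc n} (ℕ.s≤s m≤n) = begin
    fromℕ (suc m)  ≈⟨ fromℕ-suc m ⟩
    1# + fromℕ m   ≤⟨ +-monoʳ-≤ 1# (fromℕ-mono m≤n) ⟩
    1# + fromℕ n   ≈⟨ fromℕ-suc n ⟨
    fromℕ (suc n)  ∎

  fromℕ≉0 : ∀ n .{{_ : ℕ.NonZero n}} → ¬ fromℕ n ≈ 0#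
  fromℕ≉0 (suc n) 1+n≈0 = 0≉1 $ ≤.antisym 0≤1 $ begin
    1#             ≈⟨ fromℕ-1 ⟨
    fromℕ 1        ≤⟨ fromℕ-mono (ℕ.s≤s ℕ.z≤n) ⟩
    fromℕ (suc n)  ≈⟨ 1+n≈0 ⟩
    0#             ∎

  0<fromℕ : ∀ n .{{_ : ℕ.NonZero n}} → 0# < fromℕ n
  0<fromℕ n = 0≤fromℕ n , fromℕ≉0 n ∘ sym

  ⁻¹-nonNegative : ∀ {x} → 0# < x → 0# ≤ x ⁻¹
  ⁻¹-nonNegative {x} (0≤x , 0≉x) with ≤.total 0# (x ⁻¹)
  ... | inj₁ 0≤x⁻¹ = 0≤x⁻¹
  ... | inj₂ x⁻¹≤0 = contradiction (≤.antisym 0≤1 1≤0) 0≉1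
    where
    1≤0 : 1# ≤ 0#
    1≤0 = begin
      1#       ≈⟨ ⁻¹-inverseʳ x (0≉x ∘ sym) ⟨
      x * x ⁻¹ ≤⟨ *-monoˡ-≤ 0≤x x⁻¹≤0 ⟩
      x * 0#   ≈⟨ zeroʳ x ⟩
      0#       ∎

  *-cancelˡ-≤ : ∀ {z x y} → 0# < z → z * x ≤ z * y → x ≤ y
  *-cancelˡ-≤ {z} {x} {y} 0<z@(_ , 0≉z) zx≤zy = begin
    x              ≈⟨ cancel x ⟨
    z ⁻¹ * (z * x) ≤⟨ *-monoˡ-≤ (⁻¹-nonNegative 0<z) zx≤zy ⟩
    z ⁻¹ * (z * y) ≈⟨ cancel y ⟩
    y              ∎
    where
    cancel : ∀ x → z ⁻¹ * (z * x) ≈ x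
    cancel x = begin-equality
      z ⁻¹ * (z * x) ≈⟨ solve 3 (λ z i x → i :* (z :* x) := z :* i :* x) refl z (z ⁻¹) x ⟩
      z * z ⁻¹ * x   ≈⟨ *-congʳ (⁻¹-inverseʳ z (0≉z ∘ sym)) ⟩
      1# * x         ≈⟨ *-identityˡ x ⟩
      x              ∎

  ≰⇒≥ : ∀ {x y} → ¬ x ≤ y → y ≤ x
  ≰⇒≥ {x} {y} x≰y with ≤.total x y
  ... | inj₁ x≤y = contradiction x≤y x≰y
  ... | inj₂ y≤x = y≤x

  fromℕ-unbounded : ∀ {x} → ¬ (∀ n → fromℕ n ≤ x)
  fromℕ-unbounded {x} ℕ≤x
    with s , s-upper , s-least ← supremum (λ y → ∃ λ n → y ≈ fromℕ n) (fromℕ 0 , 0 , refl)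
           (x , λ { y (n , y≈n) → ≤.trans (≤.reflexive y≈n) (ℕ≤x n) })
    = 0≉1 $ ≤.antisym 0≤1 $ begin
      1#                ≈⟨ solve 1 (λ s → # 1 := # 1 :- s :+ s) refl s ⟩
      1# - s + s        ≤⟨ +-monoʳ-≤ (1# - s) (s-least (s - 1#) λ { y (n , y≈n) → begin
        y                       ≈⟨ y≈n ⟩
        fromℕ n                 ≈⟨ solve 1 (λ n → n := # 1 :+ n :- # 1) refl (fromℕ n) ⟩
        1# + fromℕ n - 1#       ≈⟨ +-congʳ (fromℕ-suc n) ⟨
        fromℕ (suc n) - 1#      ≤⟨ +-mono-≤ (s-upper (fromℕ (suc n)) (suc n , refl)) ≤.refl ⟩
        s - 1#                  ∎ }) ⟩
      1# - s + (s - 1#) ≈⟨ solve 1 (λ s → # 1 :- s :+ (s :- # 1) := # 0) refl s ⟩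
      0#                ∎

  -- The sequence is indexed from m = 0, whence the weight m + 1.
  ⟶-upperBound : ∀ {s : ℕ → Carrier} {l b K} → s ⟶ l →
                 (∀ m → 1 ℕ.≤ m → fromℕ (suc m) * (s m - b) ≤ K) → l ≤ b
  ⟶-upperBound {s} {l} {b} {K} s⟶l bound with l ≤? b
  ... | yes l≤b = l≤b
  ... | no  l≰b = contradiction n≤K/ε fromℕ-unbounded
    where
    2≉0 : ¬ fromℕ 2 ≈ 0#
    2≉0 = fromℕ≉0 2

    ε : Carrier
    ε = (l - b) * fromℕ 2 ⁻¹

    ε+ε≈l-b : ε + ε ≈ l - b
    ε+ε≈l-b = begin-equality
      ε + ε
        ≈⟨ solve 2 (λ d h → d :* h :+ d :* h := d :* (# 2 :* h)) refl (l - b) (fromℕ 2 ⁻¹) ⟩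
      (l - b) * (fromℕ 2 * fromℕ 2 ⁻¹) ≈⟨ *-congˡ (⁻¹-inverseʳ _ 2≉0) ⟩
      (l - b) * 1#                 ≈⟨ *-identityʳ _ ⟩
      l - b                        ∎

    0≤ε : 0# ≤ ε
    0≤ε = *-nonNegative (x≤y⇒0≤y-x (≰⇒≥ l≰b)) (⁻¹-nonNegative (0<fromℕ 2))

    0≉ε : ¬ 0# ≈ ε
    0≉ε 0≈ε = l≰b $ 0≤y-x⇒x≤y $ ≤.reflexive $ begin-equality
      0#          ≈⟨ solve 0 (# 0 := :- (# 0 :+ # 0)) refl ⟩
      - (0# + 0#) ≈⟨ -‿cong (+-cong 0≈ε 0≈ε) ⟩
      - (ε + ε)   ≈⟨ -‿cong ε+ε≈l-b ⟩
      - (l - b)   ≈⟨ solve 2 (λ l b → :- (l :- b) := b :- l) refl l b ⟩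
      b - l       ∎

    N : ℕ
    N = proj₁ (s⟶l ε (0≤ε , 0≉ε))

    ε≤s-b : ∀ n → N ℕ.≤ n → ε ≤ s n - b
    ε≤s-b n N≤n = begin
      ε                        ≈⟨ solve 1 (λ e → e := e :+ e :- e) refl ε ⟩
      ε + ε - ε
        ≤⟨ +-mono-≤ (≤.reflexive ε+ε≈l-b) (-‿anti-≤ (proj₁ (proj₂ (s⟶l ε (0≤ε , 0≉ε)) n N≤n))) ⟩
      l - b - ∣ s n - l ∣      ≤⟨ +-monoʳ-≤ (l - b) (-‿anti-≤ (x≤y⊔x (s n - l) (- (s n - l)))) ⟩
      l - b - - (s n - l)      ≈⟨ solve 3 (λ s l b → l :- b :- :- (s :- l) := s :- b) refl (s n) l b ⟩
      s n - b                  ∎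

    n≤K/ε : ∀ n → fromℕ n ≤ K * ε ⁻¹
    n≤K/ε n = begin
      fromℕ n                       ≈⟨ *-identityʳ _ ⟨
      fromℕ n * 1#                  ≈⟨ *-congˡ (⁻¹-inverseʳ ε (0≉ε ∘ sym)) ⟨
      fromℕ n * (ε * ε ⁻¹)          ≈⟨ *-assoc _ _ _ ⟨
      fromℕ n * ε * ε ⁻¹            ≤⟨ *-monoʳ-≤ (⁻¹-nonNegative (0≤ε , 0≉ε)) (begin
        fromℕ n * ε                   ≤⟨ *-monoʳ-≤ 0≤ε (fromℕ-mono (ℕ.m≤n⇒m≤1+n n≤k)) ⟩
        fromℕ (suc k) * ε             ≤⟨ *-monoˡ-≤ (0≤fromℕ (suc k)) (ε≤s-b k N≤k) ⟩
        fromℕ (suc k) * (s k - b)     ≤⟨ bound k (ℕ.s≤s ℕ.z≤n) ⟩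
        K                             ∎) ⟩
      K * ε ⁻¹                      ∎
      where
      k : ℕ
      k = suc (n ℕ.+ N)
      n≤k : n ℕ.≤ k
      n≤k = ℕ.m≤n⇒m≤1+n (ℕ.m≤m+n n N)
      N≤k : N ℕ.≤ k
      N≤k = ℕ.m≤n⇒m≤1+n (ℕ.m≤n+m N n)

module Bounds (ℝ : CompleteOrderedField) where
  open CompleteOrderedField ℝ
  open Simplex ℝ
  open OrderedField ℝ
  open Min totalOrder using (x≤y⇒x⊓y≈x; x≤y⇒y⊓x≈x; x⊓y≤y; ⊓-glb)
  open Algebra.Properties.Semiring.Exp semiring using (_^_; ^-congˡ)
  open Algebra.Properties.CommutativeSemiring.Exp commutativeSemiring using (^-distrib-*)

  -- The sum over permutations

  module _ (f : Fin (suc n) → ℕ) {f′ : Fin n → ℕ} (g : Fin (suc n) → Carrier) {p p′ : ℕ}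
           (f≐f′ : (λ i → f (suc i) ℕ.< p) ≐ (λ i → f′ i ℕ.< p′)) where

    private
      ∏-tail : ∏ (filter (λ i → f i ℕ.<? p) (tabulate suc)) g ≡ ∏ (below f′ p′) (g ∘ suc)
      ∏-tail = ≡.trans (≡.cong (λ is → ∏ is g) (below-tail f≐f′))
                       (≡.cong (foldr _*_ 1#) (≡.sym (List.map-∘ (below f′ p′))))

    ∏-below-accept : f 0F ℕ.< p → ∏ (below f p) g ≡ g 0F * ∏ (below f′ p′) (g ∘ suc)
    ∏-below-accept f0<p = ≡.trans
      (≡.cong (λ is → ∏ is g) (List.filter-accept (λ i → f i ℕ.<? p) f0<p))
      (≡.cong (g 0F *_) ∏-tail)

    ∏-below-reject : ¬ f 0F ℕ.< p → ∏ (below f p) g ≡ ∏ (below f′ p′) (g ∘ suc)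
    ∏-below-reject f0≮p = ≡.trans
      (≡.cong (λ is → ∏ is g) (List.filter-reject (λ i → f i ℕ.<? p) f0≮p))
      ∏-tail

  ∏-below-const : ∀ n (π : Permutation′ n) q {p} → p ℕ.≤ n →
                  ∏ (below (toℕ ∘ (π ⟨$⟩ʳ_)) p) (λ _ → q) ≡ q ^ p
  ∏-below-const zero    π q ℕ.z≤n = ≡.refl
  ∏-below-const (suc n) π q {p} p≤1+n with toℕ (π ⟨$⟩ʳ 0F) ℕ.<? p
  ∏-below-const (suc n) π q {suc p} p≤1+n | yes l<p = ≡.trans
    (∏-below-accept (toℕ ∘ (π ⟨$⟩ʳ_)) (λ _ → q)
      (punchIn-below-≤ (≡.cong toℕ ∘ punchIn-permute π 0F) (ℕ.s≤s⁻¹ l<p)) l<p)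
    (≡.cong (q *_) (∏-below-const n (remove 0F π) q (ℕ.s≤s⁻¹ p≤1+n)))
  ... | no  l≮p = ≡.trans
    (∏-below-reject (toℕ ∘ (π ⟨$⟩ʳ_)) (λ _ → q)
      (punchIn-below-≥ (≡.cong toℕ ∘ punchIn-permute π 0F) (ℕ.≮⇒≥ l≮p)) l≮p)
    (∏-below-const n (remove 0F π) q (ℕ.≤-trans (ℕ.≮⇒≥ l≮p) (ℕ.s≤s⁻¹ (Fin.toℕ<n (π ⟨$⟩ʳ 0F)))))

  module _ {M : ℕ} (j : Fin (suc (suc M))) (l : Fin (suc M)) (ρ : Permutation′ M)
           (w₁ w₂ q : Carrier) where

    private
      π : Permutation′ (suc M)
      π = insert 0F l ρ

      σ : Permutation′ (suc (suc M))
      σ = insert 0F j π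

      w : Vector Carrier (suc (suc M))
      w = w₁ ∷ᵛ w₂ ∷ᵛ replicate M q

      σ-suc : ∀ i → toℕ (σ ⟨$⟩ʳ suc i) ≡ toℕ (punchIn j (π ⟨$⟩ʳ i))
      σ-suc i = ≡.cong toℕ (insert-punchIn 0F j π i)

      π-suc : ∀ i → toℕ (π ⟨$⟩ʳ suc i) ≡ toℕ (punchIn l (ρ ⟨$⟩ʳ i))
      π-suc i = ≡.cong toℕ (insert-punchIn 0F l ρ i)

      ∏-below-π : ∏ (below (toℕ ∘ (π ⟨$⟩ʳ_)) (toℕ l)) (w ∘ suc) ≡ q ^ toℕ l
      ∏-below-π = ≡.trans
        (∏-below-reject (toℕ ∘ (π ⟨$⟩ʳ_)) (w ∘ suc) (punchIn-below-≥ π-suc ℕ.≤-refl) (ℕ.<-irrefl ≡.refl))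
        (∏-below-const M ρ q (ℕ.s≤s⁻¹ (Fin.toℕ<n l)))

    ∏-before-0 : ∏ (before σ 0F) w ≡
                 (if toℕ l ℕ.<ᵇ toℕ j then w₂ * q ^ pred (toℕ j) else q ^ toℕ j)
    ∏-before-0 = ≡.trans
      (∏-below-reject (toℕ ∘ (σ ⟨$⟩ʳ_)) w (punchIn-below-≥ σ-suc ℕ.≤-refl) (ℕ.<-irrefl ≡.refl))
      (≡-if (ℕ.<ᵇ-reflects-< (toℕ l) (toℕ j)) (accept (toℕ j) (Fin.toℕ<n j)) reject)
      where
      accept : ∀ p → p ℕ.< suc (suc M) → toℕ l ℕ.< p →
               ∏ (below (toℕ ∘ (π ⟨$⟩ʳ_)) p) (w ∘ suc) ≡ w₂ * q ^ pred p
      accept (suc p) p<2+M l<1+p = ≡.trans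
        (∏-below-accept (toℕ ∘ (π ⟨$⟩ʳ_)) (w ∘ suc) (punchIn-below-≤ π-suc (ℕ.s≤s⁻¹ l<1+p)) l<1+p)
        (≡.cong (w₂ *_) (∏-below-const M ρ q (ℕ.s≤s⁻¹ (ℕ.s≤s⁻¹ p<2+M))))
      reject : ¬ toℕ l ℕ.< toℕ j →
               ∏ (below (toℕ ∘ (π ⟨$⟩ʳ_)) (toℕ j)) (w ∘ suc) ≡ q ^ toℕ j
      reject l≮j = ≡.trans
        (∏-below-reject (toℕ ∘ (π ⟨$⟩ʳ_)) (w ∘ suc) (punchIn-below-≥ π-suc (ℕ.≮⇒≥ l≮j)) l≮j)
        (∏-below-const M ρ q (ℕ.≤-trans (ℕ.≮⇒≥ l≮j) (ℕ.s≤s⁻¹ (Fin.toℕ<n l))))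

    ∏-before-1 : ∏ (before σ 1F) w ≡
                 (if toℕ j ℕ.<ᵇ suc (toℕ l) then w₁ * q ^ toℕ l else q ^ toℕ l)
    ∏-before-1 = ≡-if (ℕ.<ᵇ-reflects-< (toℕ j) (suc (toℕ l))) accept reject
      where
      accept : toℕ j ℕ.< suc (toℕ l) → ∏ (before σ 1F) w ≡ w₁ * q ^ toℕ l
      accept j≤l rewrite ≡.trans (σ-suc 0F) (punchIn-≤ j l (ℕ.s≤s⁻¹ j≤l)) = ≡.trans
        (∏-below-accept (toℕ ∘ (σ ⟨$⟩ʳ_)) w (punchIn-below-≤ σ-suc (ℕ.s≤s⁻¹ j≤l)) j≤l)
        (≡.cong (w₁ *_) ∏-below-π)
      reject : ¬ toℕ j ℕ.< suc (toℕ l) → ∏ (before σ 1F) w ≡ q ^ toℕ l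
      reject j≰l rewrite ≡.trans (σ-suc 0F) (punchIn-> j l (ℕ.≰⇒> (j≰l ∘ ℕ.s≤s))) = ≡.trans
        (∏-below-reject (toℕ ∘ (σ ⟨$⟩ʳ_)) w
          (punchIn-below-≥ σ-suc (ℕ.<⇒≤ (ℕ.≰⇒> (j≰l ∘ ℕ.s≤s)))) (j≰l ∘ ℕ.m<n⇒m<1+n))
        ∏-below-π

  ∑-cong : ∀ (as : List A) {f g : A → Carrier} → (∀ a → f a ≈ g a) → ∑ as f ≈ ∑ as g
  ∑-cong []       f≈g = refl
  ∑-cong (a ∷ as) f≈g = +-cong (f≈g a) (∑-cong as f≈g)

  ∑-const : ∀ (as : List A) k → ∑ as (λ _ → k) ≈ fromℕ (length as) * k
  ∑-const []       k = sym (trans (*-congʳ fromℕ-0) (zeroˡ k))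
  ∑-const (a ∷ as) k = begin-equality
    k + ∑ as (λ _ → k)             ≈⟨ +-congˡ (∑-const as k) ⟩
    k + fromℕ (length as) * k
      ≈⟨ solve 2 (λ n k → k :+ n :* k := (# 1 :+ n) :* k) refl (fromℕ (length as)) k ⟩
    (1# + fromℕ (length as)) * k   ≈⟨ *-congʳ (fromℕ-suc (length as)) ⟨
    fromℕ (length (a ∷ as)) * k    ∎

  ∑-++ : ∀ (as bs : List A) f → ∑ (as ++ bs) f ≈ ∑ as f + ∑ bs f
  ∑-++ []       bs f = sym (+-identityˡ _)
  ∑-++ (a ∷ as) bs f = trans (+-congˡ (∑-++ as bs f)) (sym (+-assoc _ _ _))

  ∑-map : ∀ (h : A → B) as f → ∑ (map h as) f ≡ ∑ as (f ∘ h)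
  ∑-map h as f = ≡.cong (foldr _+_ 0#) (≡.sym (List.map-∘ as))

  ∑-permutations : ∀ n f → ∑ (permutations (suc n)) f ≈
                   ∑ (allFin (suc n)) λ j → ∑ (permutations n) λ π → f (insert 0F j π)
  ∑-permutations n f = go (allFin (suc n))
    where
    go : ∀ js → ∑ (cartesianProductWith (insert 0F) js (permutations n)) f ≈
         ∑ js λ j → ∑ (permutations n) λ π → f (insert 0F j π)
    go []       = refl
    go (j ∷ js) = trans (∑-++ (map (insert 0F j) (permutations n)) _ f)
      (+-cong (reflexive (∑-map (insert 0F j) (permutations n) f)) (go js))

  ^-nonNegative : ∀ {x} → 0# ≤ x → ∀ n → 0# ≤ x ^ n
  ^-nonNegative 0≤x zero    = 0≤1
  ^-nonNegative 0≤x (suc n) = *-nonNegative 0≤x (^-nonNegative 0≤x n)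

  sum : ℕ → (ℕ → Carrier) → Carrier
  sum zero    f = 0#
  sum (suc n) f = sum n f + f n

  sum-cong : ∀ n {f g} → (∀ i → f i ≈ g i) → sum n f ≈ sum n g
  sum-cong zero    f≈g = refl
  sum-cong (suc n) f≈g = +-cong (sum-cong n f≈g) (f≈g n)

  sum-0 : ∀ n {f} → (∀ i → f i ≈ 0#) → sum n f ≈ 0#
  sum-0 zero    f≈0 = refl
  sum-0 (suc n) f≈0 = trans (+-cong (sum-0 n f≈0) (f≈0 n)) (+-identityʳ 0#)

  sum-cong-< : ∀ n {f g} → (∀ i → i ℕ.< n → f i ≈ g i) → sum n f ≈ sum n g
  sum-cong-< zero    f≈g = refl
  sum-cong-< (suc n) f≈g =
    +-cong (sum-cong-< n (λ i i<n → f≈g i (ℕ.m<n⇒m<1+n i<n))) (f≈g n ℕ.≤-refl)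

  sum-mono-≤ : ∀ n {f g} → (∀ i → i ℕ.< n → f i ≤ g i) → sum n f ≤ sum n g
  sum-mono-≤ zero    f≤g = ≤.refl
  sum-mono-≤ (suc n) f≤g =
    +-mono-≤ (sum-mono-≤ n (λ i i<n → f≤g i (ℕ.m<n⇒m<1+n i<n))) (f≤g n ℕ.≤-refl)

  sum-+ : ∀ n f g → sum n (λ i → f i + g i) ≈ sum n f + sum n g
  sum-+ zero    f g = sym (+-identityˡ 0#)
  sum-+ (suc n) f g = begin-equality
    sum n (λ i → f i + g i) + (f n + g n) ≈⟨ +-congʳ (sum-+ n f g) ⟩
    sum n f + sum n g + (f n + g n)
      ≈⟨ solve 4 (λ a b c d → a :+ b :+ (c :+ d) := a :+ c :+ (b :+ d)) refl _ _ _ _ ⟩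
    sum n f + f n + (sum n g + g n)       ∎

  sum-* : ∀ n k f → sum n (λ i → k * f i) ≈ k * sum n f
  sum-* zero    k f = sym (zeroʳ k)
  sum-* (suc n) k f = trans (+-congʳ (sum-* n k f)) (sym (distribˡ k _ _))

  sum-suc : ∀ n f → sum (suc n) f ≈ f 0 + sum n (f ∘ suc)
  sum-suc zero    f = +-comm _ _
  sum-suc (suc n) f = trans (+-congʳ (sum-suc n f)) (+-assoc _ _ _)

  sum-swap : ∀ m n (f : ℕ → ℕ → Carrier) → sum m (λ i → sum n (f i)) ≈ sum n (λ j → sum m (λ i → f i j))
  sum-swap zero    n f = sym (sum-0 n (λ _ → refl))
  sum-swap (suc m) n f = trans (+-congʳ (sum-swap m n f)) (sym (sum-+ n _ (f m)))

  ∑-allFin : ∀ n f → ∑ (allFin n) (f ∘ toℕ) ≈ sum n f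
  ∑-allFin zero    f = refl
  ∑-allFin (suc n) f = begin-equality
    f 0 + ∑ (tabulate {n = n} suc) (f ∘ toℕ)
      ≡⟨ ≡.cong (λ is → f 0 + ∑ is (f ∘ toℕ)) (List.map-tabulate {n = n} id suc) ⟨
    f 0 + ∑ (map suc (allFin n)) (f ∘ toℕ)  ≡⟨ ≡.cong (λ y → f 0 + y) (∑-map suc (allFin n) (f ∘ toℕ)) ⟩
    f 0 + ∑ (allFin n) (f ∘ suc ∘ toℕ)      ≈⟨ +-congˡ (∑-allFin n (f ∘ suc)) ⟩
    f 0 + sum n (f ∘ suc)                   ≈⟨ sum-suc n f ⟨
    sum (suc n) f                           ∎

  sum-if-< : ∀ n {j} a b → j ℕ.≤ n →
             sum n (λ i → if i ℕ.<ᵇ j then a else b) ≈ fromℕ j * a + (fromℕ n - fromℕ j) * b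
  sum-if-< zero    a b ℕ.z≤n =
    trans (solve 2 (λ a b → # 0 := # 0 :* a :+ (# 0 :- # 0) :* b) refl a b)
          (sym (+-cong (*-congʳ fromℕ-0) (*-congʳ (+-cong fromℕ-0 (-‿cong fromℕ-0)))))
  sum-if-< (suc n) {zero} a b 0≤1+n = begin-equality
    sum n (λ _ → b) + b                         ≈⟨ +-congʳ (sum-if-< n {0} a b ℕ.z≤n) ⟩
    fromℕ 0 * a + (fromℕ n - fromℕ 0) * b + b
      ≈⟨ solve 4 (λ z n a b → z :* a :+ (n :- z) :* b :+ b := z :* a :+ ((# 1 :+ n) :- z) :* b)
          refl (fromℕ 0) (fromℕ n) a b ⟩
    fromℕ 0 * a + (1# + fromℕ n - fromℕ 0) * b  ≈⟨ +-congˡ (*-congʳ (+-congʳ (fromℕ-suc n))) ⟨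
    fromℕ 0 * a + (fromℕ (suc n) - fromℕ 0) * b ∎
  sum-if-< (suc n) {suc j} a b (ℕ.s≤s j≤n) = begin-equality
    sum (suc n) (λ i → if i ℕ.<ᵇ suc j then a else b) ≈⟨ sum-suc n _ ⟩
    a + sum n (λ i → if i ℕ.<ᵇ j then a else b)       ≈⟨ +-congˡ (sum-if-< n a b j≤n) ⟩
    a + (fromℕ j * a + (fromℕ n - fromℕ j) * b)
      ≈⟨ solve 4 (λ j n a b → a :+ (j :* a :+ (n :- j) :* b)
          := (# 1 :+ j) :* a :+ ((# 1 :+ n) :- (# 1 :+ j)) :* b) refl (fromℕ j) (fromℕ n) a b ⟩
    (1# + fromℕ j) * a + (1# + fromℕ n - (1# + fromℕ j)) * b
      ≈⟨ +-cong (*-congʳ (fromℕ-suc j)) (*-congʳ (+-cong (fromℕ-suc n) (-‿cong (fromℕ-suc j)))) ⟨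
    fromℕ (suc j) * a + (fromℕ (suc n) - fromℕ (suc j)) * b ∎

  -- For one item of weight w and n - 1 items of weight q in random order, together with a
  -- marked item, weightedSum n q w / ((n + 1) n) is the mean product of the weights of the
  -- items before the marked one.
  weightedSum : ℕ → Carrier → Carrier → Carrier
  weightedSum n q w = sum n λ l → (fromℕ (suc l) * w + (fromℕ n - fromℕ l)) * q ^ l

  module _ (M : ℕ) (q w : Carrier) where

    sum-before-0 : sum (suc (suc M)) (λ j → sum (suc M) λ l →
                     if l ℕ.<ᵇ j then w * q ^ pred j else q ^ j) ≈ weightedSum (suc M) q w
    sum-before-0 = begin-equality
      sum (suc (suc M)) (λ j → sum (suc M) λ l → if l ℕ.<ᵇ j then w * q ^ pred j else q ^ j)
        ≈⟨ sum-cong-< (suc (suc M)) (λ j j<2+M → sum-if-< (suc M) (w * q ^ pred j) (q ^ j) (ℕ.s≤s⁻¹ j<2+M)) ⟩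
      sum (suc (suc M)) (λ j → f j + g j)
        ≈⟨ sum-+ (suc (suc M)) f g ⟩
      sum (suc (suc M)) f + (sum (suc M) g + (fromℕ (suc M) - fromℕ (suc M)) * q ^ suc M)
        ≈⟨ +-congʳ (sum-suc (suc M) f) ⟩
      fromℕ 0 * (w * 1#) + sum (suc M) (f ∘ suc) + (sum (suc M) g + (fromℕ (suc M) - fromℕ (suc M)) * q ^ suc M)
        ≈⟨ +-congʳ (+-congʳ (*-congʳ fromℕ-0)) ⟩
      0# * (w * 1#) + sum (suc M) (f ∘ suc) + (sum (suc M) g + (fromℕ (suc M) - fromℕ (suc M)) * q ^ suc M)
        ≈⟨ solve 5 (λ w a b m p → # 0 :* (w :* # 1) :+ a :+ (b :+ (m :- m) :* p) := a :+ b)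
            refl w _ _ (fromℕ (suc M)) (q ^ suc M) ⟩
      sum (suc M) (f ∘ suc) + sum (suc M) g
        ≈⟨ sum-+ (suc M) (f ∘ suc) g ⟨
      sum (suc M) (λ l → f (suc l) + g l)
        ≈⟨ sum-cong (suc M) (λ l → solve 4 (λ l+1 k w p → l+1 :* (w :* p) :+ k :* p
            := (l+1 :* w :+ k) :* p) refl (fromℕ (suc l)) (fromℕ (suc M) - fromℕ l) w (q ^ l)) ⟩
      weightedSum (suc M) q w ∎
      where
      f g : ℕ → Carrier
      f j = fromℕ j * (w * q ^ pred j)
      g j = (fromℕ (suc M) - fromℕ j) * q ^ j

    sum-before-1 : sum (suc (suc M)) (λ j → sum (suc M) λ l →
                     if j ℕ.<ᵇ suc l then w * q ^ l else q ^ l) ≈ weightedSum (suc M) q w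
    sum-before-1 = begin-equality
      sum (suc (suc M)) (λ j → sum (suc M) λ l → if j ℕ.<ᵇ suc l then w * q ^ l else q ^ l)
        ≈⟨ sum-swap (suc (suc M)) (suc M) _ ⟩
      sum (suc M) (λ l → sum (suc (suc M)) λ j → if j ℕ.<ᵇ suc l then w * q ^ l else q ^ l)
        ≈⟨ sum-cong-< (suc M) (λ l l<1+M → sum-if-< (suc (suc M)) (w * q ^ l) (q ^ l) (ℕ.m<n⇒m<1+n l<1+M)) ⟩
      sum (suc M) (λ l → fromℕ (suc l) * (w * q ^ l) + (fromℕ (suc (suc M)) - fromℕ (suc l)) * q ^ l)
        ≈⟨ sum-cong (suc M) (λ l → +-congˡ (*-congʳ (+-cong (fromℕ-suc (suc M)) (-‿cong (fromℕ-suc l))))) ⟩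
      sum (suc M) (λ l → fromℕ (suc l) * (w * q ^ l) + (1# + fromℕ (suc M) - (1# + fromℕ l)) * q ^ l)
        ≈⟨ sum-cong (suc M) (λ l → solve 5 (λ l+1 l m w p →
             l+1 :* (w :* p) :+ ((# 1 :+ m) :- (# 1 :+ l)) :* p := (l+1 :* w :+ (m :- l)) :* p)
             refl (fromℕ (suc l)) (fromℕ l) (fromℕ (suc M)) w (q ^ l)) ⟩
      weightedSum (suc M) q w ∎

  sum-sum-linear : ∀ m n k a b (f g : ℕ → ℕ → Carrier) →
    sum m (λ i → sum n λ j → k * (a * f i j + b * g i j)) ≈
    k * (a * sum m (λ i → sum n (f i)) + b * sum m (λ i → sum n (g i)))
  sum-sum-linear m n k a b f g = begin-equality
    sum m (λ i → sum n λ j → k * (a * f i j + b * g i j))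
      ≈⟨ sum-cong m (λ i → linear n (f i) (g i)) ⟩
    sum m (λ i → k * (a * sum n (f i) + b * sum n (g i)))
      ≈⟨ linear m _ _ ⟩
    k * (a * sum m (λ i → sum n (f i)) + b * sum m (λ i → sum n (g i))) ∎
    where
    linear : ∀ n f g → sum n (λ j → k * (a * f j + b * g j)) ≈ k * (a * sum n f + b * sum n g)
    linear n f g = trans (sum-* n k _) (*-congˡ (trans (sum-+ n _ _) (+-cong (sum-* n a f) (sum-* n b g))))

  d-formula : ∀ M x₁ x₂ c → let q = 1# - F c in
    fromℕ (suc (suc M) ℕ.* suc M) * d (x₁ ∷ᵛ x₂ ∷ᵛ replicate M c) ≈
    F′ x₁ * weightedSum (suc M) q (1# - F x₂) + F′ x₂ * weightedSum (suc M) q (1# - F x₁)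
  d-formula M x₁ x₂ c = begin-equality
    fromℕ (suc (suc M) ℕ.* suc M) * (fromℕ (suc (suc M) !) ⁻¹ * ∑ (permutations (suc (suc M))) term)
      ≈⟨ *-congˡ (*-congˡ sum-term) ⟩
    N * (D ⁻¹ * (fromℕ (M !) * S))
      ≈⟨ solve 4 (λ n d f s → n :* (d :* (f :* s)) := (n :* f) :* d :* s) refl N (D ⁻¹) (fromℕ (M !)) S ⟩
    N * fromℕ (M !) * D ⁻¹ * S
      ≈⟨ *-congʳ (*-congʳ (fromℕ-* (suc (suc M) ℕ.* suc M) (M !))) ⟨
    fromℕ (suc (suc M) ℕ.* suc M ℕ.* M !) * D ⁻¹ * S
      ≡⟨ ≡.cong (λ k → fromℕ k * D ⁻¹ * S) (ℕ.*-assoc (suc (suc M)) (suc M) (M !)) ⟩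
    D * D ⁻¹ * S
      ≈⟨ *-congʳ (⁻¹-inverseʳ D D≉0) ⟩
    1# * S
      ≈⟨ *-identityˡ S ⟩
    S ∎
    where
    q w₁ w₂ N D S : Carrier
    q  = 1# - F c
    w₁ = 1# - F x₁
    w₂ = 1# - F x₂
    N  = fromℕ (suc (suc M) ℕ.* suc M)
    D  = fromℕ (suc (suc M) !)
    S  = F′ x₁ * weightedSum (suc M) q w₂ + F′ x₂ * weightedSum (suc M) q w₁

    x w : Vector Carrier (suc (suc M))
    x = x₁ ∷ᵛ x₂ ∷ᵛ replicate M c
    w = w₁ ∷ᵛ w₂ ∷ᵛ replicate M q

    D≉0 : ¬ D ≈ 0#
    D≉0 = fromℕ≉0 (suc (suc M) !) {{ℕ._!≢0 (suc (suc M))}}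

    term : Permutation′ (suc (suc M)) → Carrier
    term σ = F′ x₁ * ∏ (before σ 0F) (λ i → 1# - F (x i)) + F′ x₂ * ∏ (before σ 1F) (λ i → 1# - F (x i))

    1-F∘x≗w : ∀ i → 1# - F (x i) ≡ w i
    1-F∘x≗w zero          = ≡.refl
    1-F∘x≗w (suc zero)    = ≡.refl
    1-F∘x≗w (suc (suc i)) = ≡.refl

    ∏-w : ∀ is → ∏ is (λ i → 1# - F (x i)) ≡ ∏ is w
    ∏-w is = ≡.cong (foldr _*_ 1#) (List.map-cong 1-F∘x≗w is)

    f g h : ℕ → ℕ → Carrier
    f j l = if l ℕ.<ᵇ j then w₂ * q ^ pred j else q ^ j
    g j l = if j ℕ.<ᵇ suc l then w₁ * q ^ l else q ^ l
    h j l = F′ x₁ * f j l + F′ x₂ * g j l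

    term-insert : ∀ j l ρ → term (insert 0F j (insert 0F l ρ)) ≡ h (toℕ j) (toℕ l)
    term-insert j l ρ = ≡.cong₂ (λ y z → F′ x₁ * y + F′ x₂ * z)
      (≡.trans (∏-w (before (insert 0F j (insert 0F l ρ)) 0F)) (∏-before-0 j l ρ w₁ w₂ q))
      (≡.trans (∏-w (before (insert 0F j (insert 0F l ρ)) 1F)) (∏-before-1 j l ρ w₁ w₂ q))

    sum-term : ∑ (permutations (suc (suc M))) term ≈ fromℕ (M !) * S
    sum-term = begin-equality
      ∑ (permutations (suc (suc M))) term
        ≈⟨ ∑-permutations (suc M) term ⟩
      ∑ (allFin (suc (suc M))) (λ j → ∑ (permutations (suc M)) λ π → term (insert 0F j π))
        ≈⟨ ∑-cong (allFin (suc (suc M))) (λ j → ∑-permutations M (λ π → term (insert 0F j π))) ⟩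
      ∑ (allFin (suc (suc M))) (λ j → ∑ (allFin (suc M)) λ l →
        ∑ (permutations M) λ ρ → term (insert 0F j (insert 0F l ρ)))
        ≈⟨ ∑-cong (allFin (suc (suc M))) (λ j → ∑-cong (allFin (suc M)) λ l → begin-equality
             ∑ (permutations M) (λ ρ → term (insert 0F j (insert 0F l ρ)))
               ≈⟨ ∑-cong (permutations M) (λ ρ → reflexive (term-insert j l ρ)) ⟩
             ∑ (permutations M) (λ _ → h (toℕ j) (toℕ l))
               ≈⟨ ∑-const (permutations M) _ ⟩
             fromℕ (length (permutations M)) * h (toℕ j) (toℕ l)
               ≡⟨ ≡.cong (λ k → fromℕ k * h (toℕ j) (toℕ l)) (length-permutations M) ⟩
             fromℕ (M !) * h (toℕ j) (toℕ l) ∎) ⟩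
      ∑ (allFin (suc (suc M))) (λ j → ∑ (allFin (suc M)) λ l → fromℕ (M !) * h (toℕ j) (toℕ l))
        ≈⟨ ∑-cong (allFin (suc (suc M))) (λ j → ∑-allFin (suc M) (λ l → fromℕ (M !) * h (toℕ j) l)) ⟩
      ∑ (allFin (suc (suc M))) (λ j → sum (suc M) λ l → fromℕ (M !) * h (toℕ j) l)
        ≈⟨ ∑-allFin (suc (suc M)) (λ j → sum (suc M) λ l → fromℕ (M !) * h j l) ⟩
      sum (suc (suc M)) (λ j → sum (suc M) λ l → fromℕ (M !) * h j l)
        ≈⟨ sum-sum-linear (suc (suc M)) (suc M) (fromℕ (M !)) (F′ x₁) (F′ x₂) f g ⟩
      fromℕ (M !) * (F′ x₁ * sum (suc (suc M)) (λ j → sum (suc M) (f j)) +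
                     F′ x₂ * sum (suc (suc M)) (λ j → sum (suc M) (g j)))
        ≈⟨ *-congˡ (+-cong (*-congˡ (sum-before-0 M q w₂)) (*-congˡ (sum-before-1 M q w₁))) ⟩
      fromℕ (M !) * S ∎

  -- Coordinates above 6/11

  n*[x*n⁻¹]≈x : ∀ n .{{_ : ℕ.NonZero n}} x → fromℕ n * (x * fromℕ n ⁻¹) ≈ x
  n*[x*n⁻¹]≈x n x = begin-equality
    fromℕ n * (x * fromℕ n ⁻¹)
      ≈⟨ solve 3 (λ n x i → n :* (x :* i) := n :* i :* x) refl (fromℕ n) x (fromℕ n ⁻¹) ⟩
    fromℕ n * fromℕ n ⁻¹ * x    ≈⟨ *-congʳ (⁻¹-inverseʳ _ (fromℕ≉0 n)) ⟩
    1# * x                      ≈⟨ *-identityˡ x ⟩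
    x                           ∎

  n*[m/n]≈m : ∀ m n .{{_ : ℕ.NonZero n}} → fromℕ n * (m / n) ≈ fromℕ m
  n*[m/n]≈m m n = n*[x*n⁻¹]≈x n (fromℕ m)

  /-nonNegative : ∀ m n .{{_ : ℕ.NonZero n}} → 0# ≤ m / n
  /-nonNegative m n = *-nonNegative (0≤fromℕ m) (⁻¹-nonNegative (0<fromℕ n))

  11/6*6/11≈1 : 11 / 6 * (6 / 11) ≈ 1#
  11/6*6/11≈1 = begin-equality
    11 / 6 * (6 / 11)
      ≈⟨ solve 4 (λ a b c d → a :* b :* (c :* d) := (c :* (a :* b)) :* d)
          refl (fromℕ 11) (fromℕ 6 ⁻¹) (fromℕ 6) (fromℕ 11 ⁻¹) ⟩
    fromℕ 6 * (11 / 6) * fromℕ 11 ⁻¹ ≈⟨ *-congʳ (n*[m/n]≈m 11 6) ⟩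
    fromℕ 11 * fromℕ 11 ⁻¹           ≈⟨ ⁻¹-inverseʳ _ (fromℕ≉0 11) ⟩
    1#                 ∎

  F≤1 : ∀ z → F z ≤ 1#
  F≤1 z = x⊓y≤y _ 1#

  0≤F : ∀ {z} → 0# ≤ z → 0# ≤ F z
  0≤F 0≤z = ⊓-glb (*-nonNegative (/-nonNegative 11 6) 0≤z) 0≤1

  F-linear : ∀ {z} → 11 / 6 * z ≤ 1# → F z ≈ 11 / 6 * z
  F-linear = x≤y⇒x⊓y≈x

  F-small : ∀ {z} → z ≤ 6 / 11 → F z ≈ 11 / 6 * z
  F-small z≤6/11 = F-linear (≤.trans (*-monoˡ-≤ (/-nonNegative 11 6) z≤6/11) (≤.reflexive 11/6*6/11≈1))

  F-large : ∀ {z} → ¬ z ≤ 6 / 11 → F z ≈ 1#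
  F-large z≰6/11 = x≤y⇒y⊓x≈x $
    ≤.trans (≤.reflexive (sym 11/6*6/11≈1)) (*-monoˡ-≤ (/-nonNegative 11 6) (≰⇒≥ z≰6/11))

  F′-small : ∀ {z} → z ≤ 6 / 11 → F′ z ≡ 11 / 6
  F′-small {z} z≤6/11 with z ≤? 6 / 11
  ... | yes _      = ≡.refl
  ... | no  z≰6/11 = contradiction z≤6/11 z≰6/11

  F′-large : ∀ {z} → ¬ z ≤ 6 / 11 → F′ z ≡ 0#
  F′-large {z} z≰6/11 with z ≤? 6 / 11
  ... | yes z≤6/11 = contradiction z≤6/11 z≰6/11
  ... | no  _      = ≡.refl

  F′≤11/6 : ∀ z → F′ z ≤ 11 / 6
  F′≤11/6 z with z ≤? 6 / 11
  ... | yes _ = ≤.refl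
  ... | no  _ = /-nonNegative 11 6

  ^-≤1 : ∀ {x} → 0# ≤ x → x ≤ 1# → ∀ n → x ^ n ≤ 1#
  ^-≤1 0≤x x≤1 zero    = ≤.refl
  ^-≤1 {x} 0≤x x≤1 (suc n) = begin
    x * x ^ n ≤⟨ *-monoˡ-≤ 0≤x (^-≤1 0≤x x≤1 n) ⟩
    x * 1#    ≈⟨ *-identityʳ x ⟩
    x         ≤⟨ x≤1 ⟩
    1#        ∎

  sum-descending : ∀ n k → fromℕ 2 * sum n (λ l → k - fromℕ l) ≈ fromℕ n * (fromℕ 2 * k + 1# - fromℕ n)
  sum-descending zero    k = trans (zeroʳ _) (sym (trans (*-congʳ fromℕ-0) (zeroˡ _)))
  sum-descending (suc n) k = begin-equality
    fromℕ 2 * (sum n (λ l → k - fromℕ l) + (k - fromℕ n))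
      ≈⟨ distribˡ _ _ _ ⟩
    fromℕ 2 * sum n (λ l → k - fromℕ l) + fromℕ 2 * (k - fromℕ n)
      ≈⟨ +-congʳ (sum-descending n k) ⟩
    fromℕ n * (fromℕ 2 * k + 1# - fromℕ n) + fromℕ 2 * (k - fromℕ n)
      ≈⟨ solve 2 (λ n k → n :* (# 2 :* k :+ # 1 :- n) :+ # 2 :* (k :- n)
          := (# 1 :+ n) :* (# 2 :* k :+ # 1 :- (# 1 :+ n))) refl (fromℕ n) k ⟩
    (1# + fromℕ n) * (fromℕ 2 * k + 1# - (1# + fromℕ n))
      ≈⟨ *-cong (fromℕ-suc n) (+-congˡ (-‿cong (fromℕ-suc n))) ⟨
    fromℕ (suc n) * (fromℕ 2 * k + 1# - fromℕ (suc n)) ∎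

  weightedSum-cong : ∀ n q {w w′} → w ≈ w′ → weightedSum n q w ≈ weightedSum n q w′
  weightedSum-cong n q w≈w′ = sum-cong n (λ l → *-congʳ (+-congʳ (*-congˡ w≈w′)))

  weightedSum-0-≤ : ∀ n {q} → 0# ≤ q → q ≤ 1# →
                    fromℕ 2 * weightedSum n q 0# ≤ fromℕ (suc n ℕ.* n)
  weightedSum-0-≤ n {q} 0≤q q≤1 = begin
    fromℕ 2 * weightedSum n q 0#           ≤⟨ *-monoˡ-≤ (0≤fromℕ 2) (sum-mono-≤ n λ l l<n → begin
      (fromℕ (suc l) * 0# + (fromℕ n - fromℕ l)) * q ^ l
        ≈⟨ solve 3 (λ l+1 k p → (l+1 :* # 0 :+ k) :* p := k :* p)
            refl (fromℕ (suc l)) (fromℕ n - fromℕ l) (q ^ l) ⟩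
      (fromℕ n - fromℕ l) * q ^ l
        ≤⟨ *-monoˡ-≤ (x≤y⇒0≤y-x (fromℕ-mono (ℕ.<⇒≤ l<n))) (^-≤1 0≤q q≤1 l) ⟩
      (fromℕ n - fromℕ l) * 1#             ≈⟨ *-identityʳ _ ⟩
      fromℕ n - fromℕ l                    ∎) ⟩
    fromℕ 2 * sum n (λ l → fromℕ n - fromℕ l) ≈⟨ sum-descending n (fromℕ n) ⟩
    fromℕ n * (fromℕ 2 * fromℕ n + 1# - fromℕ n)
      ≈⟨ solve 1 (λ n → n :* (# 2 :* n :+ # 1 :- n) := (# 1 :+ n) :* n) refl (fromℕ n) ⟩
    (1# + fromℕ n) * fromℕ n               ≈⟨ *-congʳ (fromℕ-suc n) ⟨
    fromℕ (suc n) * fromℕ n                ≈⟨ fromℕ-* (suc n) n ⟨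
    fromℕ (suc n ℕ.* n)                    ∎

  weightedSum-large : ∀ n {q x y} → 0# ≤ q → q ≤ 1# → ¬ x ≤ 6 / 11 →
    fromℕ 12 * (F′ x * weightedSum n q (1# - F y) + F′ y * weightedSum n q (1# - F x)) ≤
    fromℕ 11 * fromℕ (suc n ℕ.* n)
  weightedSum-large n {q} {x} {y} 0≤q q≤1 x≰6/11 = begin
    fromℕ 12 * (F′ x * weightedSum n q (1# - F y) + F′ y * weightedSum n q (1# - F x))
      ≈⟨ *-congˡ (+-cong (*-congʳ (reflexive (F′-large x≰6/11))) (*-congˡ (weightedSum-cong n q 1-Fx≈0))) ⟩
    fromℕ 12 * (0# * weightedSum n q (1# - F y) + F′ y * weightedSum n q 0#)
      ≈⟨ solve 3 (λ v f w → # 12 :* (# 0 :* v :+ f :* w) := # 6 :* (f :* (# 2 :* w)))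
          refl (weightedSum n q (1# - F y)) (F′ y) (weightedSum n q 0#) ⟩
    fromℕ 6 * (F′ y * (fromℕ 2 * weightedSum n q 0#))
      ≤⟨ *-monoˡ-≤ (0≤fromℕ 6) (*-monoˡ-≤ 0≤F′y (weightedSum-0-≤ n 0≤q q≤1)) ⟩
    fromℕ 6 * (F′ y * fromℕ (suc n ℕ.* n))
      ≤⟨ *-monoˡ-≤ (0≤fromℕ 6) (*-monoʳ-≤ (0≤fromℕ (suc n ℕ.* n)) (F′≤11/6 y)) ⟩
    fromℕ 6 * (11 / 6 * fromℕ (suc n ℕ.* n))
      ≈⟨ *-assoc _ _ _ ⟨
    fromℕ 6 * (11 / 6) * fromℕ (suc n ℕ.* n)
      ≈⟨ *-congʳ (n*[m/n]≈m 11 6) ⟩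
    fromℕ 11 * fromℕ (suc n ℕ.* n) ∎
    where
    1-Fx≈0 : 1# - F x ≈ 0#
    1-Fx≈0 = trans (+-congˡ (-‿cong (F-large x≰6/11))) (-‿inverseʳ 1#)
    0≤F′y : 0# ≤ F′ y
    0≤F′y with y ≤? 6 / 11
    ... | yes _ = /-nonNegative 11 6
    ... | no  _ = ≤.refl

  C-remaining : ℕ → Carrier → Carrier → Carrier
  C-remaining m x₁ x₂ = (1# - x₁ - x₂) * fromℕ (suc m) ⁻¹

  C-formula : ∀ m x₁ x₂ → let q = 1# - F (C-remaining m x₁ x₂) ; n = suc (suc m) in
    fromℕ (suc n ℕ.* n) * C m x₁ x₂ ≈
    F′ x₁ * weightedSum n q (1# - F x₂) + F′ x₂ * weightedSum n q (1# - F x₁)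
  C-formula m x₁ x₂ = d-formula (suc m) x₁ x₂ (C-remaining m x₁ x₂)

  C-remaining-nonNegative : ∀ m {x₁ x₂} → x₁ + x₂ ≤ 1# → 0# ≤ C-remaining m x₁ x₂
  C-remaining-nonNegative m {x₁} {x₂} x₁+x₂≤1 = *-nonNegative
    (≤.trans (x≤y⇒0≤y-x x₁+x₂≤1) (≤.reflexive (solve 2 (λ x y → # 1 :- (x :+ y) := # 1 :- x :- y)
        refl x₁ x₂)))
    (⁻¹-nonNegative (0<fromℕ (suc m)))

  C-≤-11/12 : ∀ m {x₁ x₂ s} → fromℕ (suc (suc (suc m)) ℕ.* suc (suc m)) * C m x₁ x₂ ≈ s →
              fromℕ 12 * s ≤ fromℕ 11 * fromℕ (suc (suc (suc m)) ℕ.* suc (suc m)) → C m x₁ x₂ ≤ 11 / 12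
  C-≤-11/12 m {x₁} {x₂} {s} NC≈s 12s≤11N = *-cancelˡ-≤ (0<fromℕ 12) $ *-cancelˡ-≤ (0<fromℕ N) $ begin
    fromℕ N * (fromℕ 12 * C m x₁ x₂)
      ≈⟨ solve 3 (λ n k c → n :* (k :* c) := k :* (n :* c)) refl (fromℕ N) (fromℕ 12) (C m x₁ x₂) ⟩
    fromℕ 12 * (fromℕ N * C m x₁ x₂)   ≈⟨ *-congˡ NC≈s ⟩
    fromℕ 12 * s                       ≤⟨ 12s≤11N ⟩
    fromℕ 11 * fromℕ N                 ≈⟨ *-comm _ _ ⟩
    fromℕ N * fromℕ 11                 ≈⟨ *-congˡ (n*[m/n]≈m 11 12) ⟨
    fromℕ N * (fromℕ 12 * (11 / 12))   ∎
    where
    N : ℕ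
    N = suc (suc (suc m)) ℕ.* suc (suc m)

  0≤1-F : ∀ z → 0# ≤ 1# - F z
  0≤1-F z = x≤y⇒0≤y-x (F≤1 z)

  1-F≤1 : ∀ {z} → 0# ≤ z → 1# - F z ≤ 1#
  1-F≤1 {z} 0≤z = begin
    1# - F z  ≤⟨ +-monoʳ-≤ 1# (-‿anti-≤ (0≤F 0≤z)) ⟩
    1# - 0#   ≈⟨ solve 0 (# 1 :- # 0 := # 1) refl ⟩
    1#        ∎

  module _ (m : ℕ) {x₁ x₂ : Carrier} (x₁+x₂≤1 : x₁ + x₂ ≤ 1#) where
    private
      0≤c : 0# ≤ C-remaining m x₁ x₂
      0≤c = C-remaining-nonNegative m x₁+x₂≤1

    C-large₁ : ¬ x₁ ≤ 6 / 11 → C m x₁ x₂ ≤ 11 / 12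
    C-large₁ x₁≰6/11 = C-≤-11/12 m (C-formula m x₁ x₂)
      (weightedSum-large (suc (suc m)) (0≤1-F _) (1-F≤1 0≤c) x₁≰6/11)

    C-large₂ : ¬ x₂ ≤ 6 / 11 → C m x₁ x₂ ≤ 11 / 12
    C-large₂ x₂≰6/11 = C-≤-11/12 m (trans (C-formula m x₁ x₂) (+-comm _ _))
      (weightedSum-large (suc (suc m)) (0≤1-F _) (1-F≤1 0≤c) x₂≰6/11)

  -- Binomial coefficients and the Bonferroni inequalities

  binomial : ℕ → ℕ → Carrier
  binomial n k = fromℕ (n choose k)

  binomial-0 : ∀ n → binomial n 0 ≈ 1#
  binomial-0 n = fromℕ-1

  binomial-0-suc : ∀ k → binomial 0 (suc k) ≈ 0#
  binomial-0-suc k = trans (reflexive (≡.cong fromℕ (k>n⇒nCk≡0 {0} {suc k} ℕ.z<s))) fromℕ-0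

  pascal : ∀ n k → binomial (suc n) (suc k) ≈ binomial n k + binomial n (suc k)
  pascal n k = trans (reflexive (≡.cong fromℕ (≡.sym (nCk+nC[k+1]≡[n+1]C[k+1] n k)))) (fromℕ-+ _ _)

  k*binomial-0 : ∀ k → fromℕ k * binomial 0 k ≈ 0#
  k*binomial-0 zero    = trans (*-congʳ fromℕ-0) (zeroˡ _)
  k*binomial-0 (suc k) = trans (*-congˡ (binomial-0-suc k)) (zeroʳ _)

  absorption : ∀ n k → (1# + fromℕ k) * binomial (suc n) (suc k) ≈ (1# + fromℕ n) * binomial n k
  absorption zero k = begin-equality
    (1# + fromℕ k) * binomial 1 (suc k)
      ≈⟨ *-congˡ (trans (pascal 0 k) (+-congˡ (binomial-0-suc k))) ⟩
    (1# + fromℕ k) * (binomial 0 k + 0#)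
      ≈⟨ solve 2 (λ k b → (# 1 :+ k) :* (b :+ # 0) := b :+ k :* b) refl (fromℕ k) (binomial 0 k) ⟩
    binomial 0 k + fromℕ k * binomial 0 k                ≈⟨ +-congˡ (k*binomial-0 k) ⟩
    binomial 0 k + 0#
      ≈⟨ solve 1 (λ b → b :+ # 0 := (# 1 :+ # 0) :* b) refl (binomial 0 k) ⟩
    (1# + 0#) * binomial 0 k                             ≈⟨ *-congʳ (+-congˡ fromℕ-0) ⟨
    (1# + fromℕ 0) * binomial 0 k                        ∎
  absorption (suc n) zero = begin-equality
    (1# + fromℕ 0) * binomial (suc (suc n)) 1            ≈⟨ *-congˡ (pascal (suc n) 0) ⟩
    (1# + fromℕ 0) * (binomial (suc n) 0 + binomial (suc n) 1)   ≈⟨ distribˡ _ _ _ ⟩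
    (1# + fromℕ 0) * binomial (suc n) 0 + (1# + fromℕ 0) * binomial (suc n) 1
      ≈⟨ +-congˡ (absorption n 0) ⟩
    (1# + fromℕ 0) * binomial (suc n) 0 + (1# + fromℕ n) * binomial n 0
      ≈⟨ +-cong (*-congʳ (+-congˡ fromℕ-0))
                (*-cong (sym (fromℕ-suc n)) (trans (binomial-0 n) (sym (binomial-0 (suc n))))) ⟩
    (1# + 0#) * binomial (suc n) 0 + fromℕ (suc n) * binomial (suc n) 0
      ≈⟨ solve 2 (λ n b → (# 1 :+ # 0) :* b :+ n :* b := (# 1 :+ n) :* b)
          refl (fromℕ (suc n)) (binomial (suc n) 0) ⟩
    (1# + fromℕ (suc n)) * binomial (suc n) 0 ∎
  absorption (suc n) (suc k) = begin-equality
    (1# + fromℕ (suc k)) * binomial (suc (suc n)) (suc (suc k))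
      ≈⟨ *-congˡ (pascal (suc n) (suc k)) ⟩
    (1# + fromℕ (suc k)) * (X + binomial (suc n) (suc (suc k)))
      ≈⟨ distribˡ _ _ _ ⟩
    (1# + fromℕ (suc k)) * X + (1# + fromℕ (suc k)) * binomial (suc n) (suc (suc k))
      ≈⟨ +-cong (*-congʳ (+-congˡ (fromℕ-suc k))) (absorption n (suc k)) ⟩
    (1# + (1# + fromℕ k)) * X + (1# + fromℕ n) * W
      ≈⟨ solve 4 (λ k x n w → (# 1 :+ (# 1 :+ k)) :* x :+ (# 1 :+ n) :* w
          := x :+ ((# 1 :+ k) :* x :+ (# 1 :+ n) :* w)) refl (fromℕ k) X (fromℕ n) W ⟩
    X + ((1# + fromℕ k) * X + (1# + fromℕ n) * W)
      ≈⟨ +-congˡ (+-congʳ (absorption n k)) ⟩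
    X + ((1# + fromℕ n) * binomial n k + (1# + fromℕ n) * W)
      ≈⟨ +-congˡ (trans (sym (distribˡ _ _ _)) (*-cong (sym (fromℕ-suc n)) (sym (pascal n k)))) ⟩
    X + fromℕ (suc n) * X
      ≈⟨ solve 2 (λ n x → x :+ n :* x := (# 1 :+ n) :* x) refl (fromℕ (suc n)) X ⟩
    (1# + fromℕ (suc n)) * X ∎
    where
    X W : Carrier
    X = binomial (suc n) (suc k)
    W = binomial n (suc k)

  binomial-sucˡ : ∀ n k → (1# + fromℕ n) * binomial n k ≈ (1# + fromℕ n - fromℕ k) * binomial (suc n) k
  binomial-sucˡ n zero = *-cong
    (trans (solve 1 (λ n → # 1 :+ n := # 1 :+ n :- # 0) refl (fromℕ n)) (+-congˡ (-‿cong (sym fromℕ-0))))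
    (trans (binomial-0 n) (sym (binomial-0 (suc n))))
  binomial-sucˡ n (suc k) = begin-equality
    (1# + fromℕ n) * W
      ≈⟨ solve 3 (λ n y w → (# 1 :+ n) :* w := (# 1 :+ n) :* (y :+ w) :- (# 1 :+ n) :* y)
          refl (fromℕ n) Y W ⟩
    (1# + fromℕ n) * (Y + W) - (1# + fromℕ n) * Y
      ≈⟨ +-cong (*-congˡ (sym (pascal n k))) (-‿cong (sym (absorption n k))) ⟩
    (1# + fromℕ n) * X - (1# + fromℕ k) * X
      ≈⟨ solve 3 (λ n k+1 x → (# 1 :+ n) :* x :- k+1 :* x := (# 1 :+ n :- k+1) :* x)
          refl (fromℕ n) (1# + fromℕ k) X ⟩
    (1# + fromℕ n - (1# + fromℕ k)) * X
      ≈⟨ *-congʳ (+-congˡ (-‿cong (fromℕ-suc k))) ⟨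
    (1# + fromℕ n - fromℕ (suc k)) * X ∎
    where
    X Y W : Carrier
    X = binomial (suc n) (suc k)
    Y = binomial n k
    W = binomial n (suc k)

  binomial-sucʳ : ∀ n k → (1# + fromℕ k) * binomial n (suc k) ≈ (fromℕ n - fromℕ k) * binomial n k
  binomial-sucʳ n k = begin-equality
    (1# + fromℕ k) * W
      ≈⟨ solve 3 (λ k y w → (# 1 :+ k) :* w := (# 1 :+ k) :* (y :+ w) :- (# 1 :+ k) :* y)
          refl (fromℕ k) Y W ⟩
    (1# + fromℕ k) * (Y + W) - (1# + fromℕ k) * Y
      ≈⟨ +-congʳ (trans (*-congˡ (sym (pascal n k))) (absorption n k)) ⟩
    (1# + fromℕ n) * Y - (1# + fromℕ k) * Y
      ≈⟨ solve 3 (λ n k y → (# 1 :+ n) :* y :- (# 1 :+ k) :* y := (n :- k) :* y)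
          refl (fromℕ n) (fromℕ k) Y ⟩
    (fromℕ n - fromℕ k) * Y ∎
    where
    Y W : Carrier
    Y = binomial n k
    W = binomial n (suc k)

  sum-binomial : ∀ n k → (1# + fromℕ k) * sum (suc n) (λ l → binomial l k) ≈ (1# + fromℕ n) * binomial n k
  sum-binomial zero k = begin-equality
    (1# + fromℕ k) * (0# + binomial 0 k)
      ≈⟨ solve 2 (λ k b → (# 1 :+ k) :* (# 0 :+ b) := b :+ k :* b) refl (fromℕ k) (binomial 0 k) ⟩
    binomial 0 k + fromℕ k * binomial 0 k  ≈⟨ +-congˡ (k*binomial-0 k) ⟩
    binomial 0 k + 0#
      ≈⟨ solve 1 (λ b → b :+ # 0 := (# 1 :+ # 0) :* b) refl (binomial 0 k) ⟩
    (1# + 0#) * binomial 0 k               ≈⟨ *-congʳ (+-congˡ fromℕ-0) ⟨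
    (1# + fromℕ 0) * binomial 0 k          ∎
  sum-binomial (suc n) k = begin-equality
    (1# + fromℕ k) * (sum (suc n) (λ l → binomial l k) + binomial (suc n) k)
      ≈⟨ distribˡ _ _ _ ⟩
    (1# + fromℕ k) * sum (suc n) (λ l → binomial l k) + (1# + fromℕ k) * binomial (suc n) k
      ≈⟨ +-congʳ (trans (sum-binomial n k) (binomial-sucˡ n k)) ⟩
    (1# + fromℕ n - fromℕ k) * binomial (suc n) k + (1# + fromℕ k) * binomial (suc n) k
      ≈⟨ solve 3 (λ n k b → (# 1 :+ n :- k) :* b :+ (# 1 :+ k) :* b := (# 1 :+ (# 1 :+ n)) :* b)
          refl (fromℕ n) (fromℕ k) (binomial (suc n) k) ⟩
    (1# + (1# + fromℕ n)) * binomial (suc n) k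
      ≈⟨ *-congʳ (+-congˡ (fromℕ-suc n)) ⟨
    (1# + fromℕ (suc n)) * binomial (suc n) k ∎

  sum-l*binomial : ∀ n k → (1# + (1# + fromℕ k)) * sum (suc n) (λ l → fromℕ (suc l) * binomial l k) ≈
                   (1# + (1# + fromℕ n)) * (1# + fromℕ n) * binomial n k
  sum-l*binomial zero k = begin-equality
    (1# + (1# + fromℕ k)) * (0# + fromℕ 1 * binomial 0 k) ≈⟨ *-congˡ (+-congˡ (*-congʳ fromℕ-1)) ⟩
    (1# + (1# + fromℕ k)) * (0# + 1# * binomial 0 k)
      ≈⟨ solve 2 (λ k b → (# 1 :+ (# 1 :+ k)) :* (# 0 :+ # 1 :* b) := # 2 :* b :+ k :* b)
          refl (fromℕ k) (binomial 0 k) ⟩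
    fromℕ 2 * binomial 0 k + fromℕ k * binomial 0 k  ≈⟨ +-congˡ (k*binomial-0 k) ⟩
    fromℕ 2 * binomial 0 k + 0#
      ≈⟨ solve 1 (λ b → # 2 :* b :+ # 0 := (# 1 :+ (# 1 :+ # 0)) :* (# 1 :+ # 0) :* b)
          refl (binomial 0 k) ⟩
    (1# + (1# + 0#)) * (1# + 0#) * binomial 0 k
      ≈⟨ *-congʳ (*-cong (+-congˡ (+-congˡ fromℕ-0)) (+-congˡ fromℕ-0)) ⟨
    (1# + (1# + fromℕ 0)) * (1# + fromℕ 0) * binomial 0 k ∎
  sum-l*binomial (suc n) k = begin-equality
    (1# + (1# + fromℕ k)) * (sum (suc n) (λ l → fromℕ (suc l) * binomial l k) + fromℕ (suc (suc n)) * b)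
      ≈⟨ distribˡ _ _ _ ⟩
    (1# + (1# + fromℕ k)) * sum (suc n) (λ l → fromℕ (suc l) * binomial l k) +
    (1# + (1# + fromℕ k)) * (fromℕ (suc (suc n)) * b)
      ≈⟨ +-cong (trans (sum-l*binomial n k) (trans (*-assoc _ _ _) (*-congˡ (binomial-sucˡ n k))))
                (*-congˡ (*-congʳ (fromℕ-2+ n))) ⟩
    (1# + (1# + fromℕ n)) * ((1# + fromℕ n - fromℕ k) * b) +
    (1# + (1# + fromℕ k)) * ((1# + (1# + fromℕ n)) * b)
      ≈⟨ solve 3 (λ n k b →
           (# 1 :+ (# 1 :+ n)) :* ((# 1 :+ n :- k) :* b) :+ (# 1 :+ (# 1 :+ k)) :* ((# 1 :+ (# 1 :+ n)) :* b)
           := (# 1 :+ (# 1 :+ (# 1 :+ n))) :* (# 1 :+ (# 1 :+ n)) :* b)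
           refl (fromℕ n) (fromℕ k) b ⟩
    (1# + (1# + (1# + fromℕ n))) * (1# + (1# + fromℕ n)) * b
      ≈⟨ *-congʳ (*-cong (+-congˡ (+-congˡ (fromℕ-suc n))) (+-congˡ (fromℕ-suc n))) ⟨
    (1# + (1# + fromℕ (suc n))) * (1# + fromℕ (suc n)) * b ∎
    where
    b : Carrier
    b = binomial (suc n) k

  -- The partial sums of the expansion of (1 - z) ^ l are alternately below and above it.
  binomialSum : ℕ → Carrier → ℕ → Carrier
  binomialSum k z l = sum k λ i → (- z) ^ i * binomial l i

  binomialSum-0 : ∀ k z → binomialSum (suc k) z 0 ≈ 1#
  binomialSum-0 k z = begin-equality
    binomialSum (suc k) z 0
      ≈⟨ sum-suc k _ ⟩
    1# * binomial 0 0 + sum k (λ i → (- z) ^ suc i * binomial 0 (suc i))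
      ≈⟨ +-cong (*-congˡ (binomial-0 0)) (sum-0 k (λ i → trans (*-congˡ (binomial-0-suc i)) (zeroʳ _))) ⟩
    1# * 1# + 0#
      ≈⟨ solve 0 (# 1 :* # 1 :+ # 0 := # 1) refl ⟩
    1# ∎

  binomialSum-suc : ∀ k z l → binomialSum (suc k) z (suc l) ≈ binomialSum (suc k) z l - z * binomialSum k z l
  binomialSum-suc k z l = begin-equality
    binomialSum (suc k) z (suc l)
      ≈⟨ sum-suc k _ ⟩
    1# * binomial (suc l) 0 + sum k (λ i → (- z) ^ suc i * binomial (suc l) (suc i))
      ≈⟨ +-cong (*-congˡ (trans (binomial-0 (suc l)) (sym (binomial-0 l))))
                (sum-cong k (λ i → trans (*-congˡ (pascal l i))
                  (solve 4 (λ z p b b′ → :- z :* p :* (b :+ b′) := :- z :* p :* b′ :+ :- z :* (p :* b))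
                    refl z ((- z) ^ i) (binomial l i) (binomial l (suc i))))) ⟩
    1# * binomial l 0 + sum k (λ i → (- z) ^ suc i * binomial l (suc i) + - z * ((- z) ^ i * binomial l i))
      ≈⟨ +-congˡ (trans (sum-+ k _ _) (+-congˡ (sum-* k (- z) _))) ⟩
    1# * binomial l 0 + (sum k (λ i → (- z) ^ suc i * binomial l (suc i)) + - z * binomialSum k z l)
      ≈⟨ solve 4 (λ a b z t → a :+ (b :+ :- z :* t) := a :+ b :- z :* t) refl _ _ z (binomialSum k z l) ⟩
    1# * binomial l 0 + sum k (λ i → (- z) ^ suc i * binomial l (suc i)) - z * binomialSum k z l
      ≈⟨ +-congʳ (sum-suc k _) ⟨
    binomialSum (suc k) z l - z * binomialSum k z l ∎

  module _ {z : Carrier} (0≤z : 0# ≤ z) (z≤1 : z ≤ 1#) where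

    private
      ^-suc : ∀ l → (1# - z) ^ suc l ≈ (1# - z) ^ l - z * (1# - z) ^ l
      ^-suc l = solve 2 (λ z p → (# 1 :- z) :* p := p :- z :* p) refl z ((1# - z) ^ l)

    binomialSum-upper : ∀ k → (∀ l → binomialSum k z l ≤ (1# - z) ^ l) →
                        ∀ l → (1# - z) ^ l ≤ binomialSum (suc k) z l
    binomialSum-upper k lower zero    = ≤.reflexive (sym (binomialSum-0 k z))
    binomialSum-upper k lower (suc l) = begin
      (1# - z) ^ suc l                                ≈⟨ ^-suc l ⟩
      (1# - z) ^ l - z * (1# - z) ^ l
        ≤⟨ +-mono-≤ (binomialSum-upper k lower l) (-‿anti-≤ (*-monoˡ-≤ 0≤z (lower l))) ⟩
      binomialSum (suc k) z l - z * binomialSum k z l ≈⟨ binomialSum-suc k z l ⟨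
      binomialSum (suc k) z (suc l)                   ∎

    binomialSum-lower : ∀ k → (∀ l → (1# - z) ^ l ≤ binomialSum k z l) →
                        ∀ l → binomialSum (suc k) z l ≤ (1# - z) ^ l
    binomialSum-lower k upper zero    = ≤.reflexive (binomialSum-0 k z)
    binomialSum-lower k upper (suc l) = begin
      binomialSum (suc k) z (suc l)                   ≈⟨ binomialSum-suc k z l ⟩
      binomialSum (suc k) z l - z * binomialSum k z l
        ≤⟨ +-mono-≤ (binomialSum-lower k upper l) (-‿anti-≤ (*-monoˡ-≤ 0≤z (upper l))) ⟩
      (1# - z) ^ l - z * (1# - z) ^ l                 ≈⟨ ^-suc l ⟨
      (1# - z) ^ suc l                                ∎

    binomialSum-even : ∀ r l → binomialSum (r ℕ.* 2) z l ≤ (1# - z) ^ l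
    binomialSum-odd  : ∀ r l → (1# - z) ^ l ≤ binomialSum (suc (r ℕ.* 2)) z l
    binomialSum-even zero    l = ^-nonNegative (x≤y⇒0≤y-x z≤1) l
    binomialSum-even (suc r) l = binomialSum-lower (suc (r ℕ.* 2)) (binomialSum-odd r) l
    binomialSum-odd  r       l = binomialSum-upper (r ℕ.* 2) (binomialSum-even r) l

  n*x≈y⇒x≈y*n⁻¹ : ∀ n .{{_ : ℕ.NonZero n}} {x y} → fromℕ n * x ≈ y → x ≈ y * fromℕ n ⁻¹
  n*x≈y⇒x≈y*n⁻¹ n {x} {y} nx≈y = begin-equality
    x                            ≈⟨ n*[x*n⁻¹]≈x n x ⟨
    fromℕ n * (x * fromℕ n ⁻¹)   ≈⟨ *-assoc _ _ _ ⟨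
    fromℕ n * x * fromℕ n ⁻¹     ≈⟨ *-congʳ nx≈y ⟩
    y * fromℕ n ⁻¹               ∎

  -- moment w i is the integral of (2 - w τ) τ ^ i over 0 ≤ τ ≤ 1.
  moment : Carrier → ℕ → Carrier
  moment w i = fromℕ 2 * fromℕ (suc i) ⁻¹ - w * fromℕ (suc (suc i)) ⁻¹

  moment-nonNegative : ∀ {w} → w ≤ fromℕ 2 → ∀ i → 0# ≤ moment w i
  moment-nonNegative {w} w≤2 i = x≤y⇒0≤y-x $ begin
    w * fromℕ (2 ℕ.+ i) ⁻¹         ≤⟨ *-monoʳ-≤ (⁻¹-nonNegative (0<fromℕ (2 ℕ.+ i))) w≤2 ⟩
    fromℕ 2 * fromℕ (2 ℕ.+ i) ⁻¹   ≤⟨ *-monoˡ-≤ (0≤fromℕ 2) antitone ⟩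
    fromℕ 2 * fromℕ (1 ℕ.+ i) ⁻¹   ∎
    where
    antitone : fromℕ (2 ℕ.+ i) ⁻¹ ≤ fromℕ (1 ℕ.+ i) ⁻¹
    antitone = *-cancelˡ-≤ (0<fromℕ (2 ℕ.+ i)) $ begin
      fromℕ (2 ℕ.+ i) * fromℕ (2 ℕ.+ i) ⁻¹  ≈⟨ ⁻¹-inverseʳ _ (fromℕ≉0 (2 ℕ.+ i)) ⟩
      1#                                    ≈⟨ ⁻¹-inverseʳ _ (fromℕ≉0 (1 ℕ.+ i)) ⟨
      fromℕ (1 ℕ.+ i) * fromℕ (1 ℕ.+ i) ⁻¹
        ≤⟨ *-monoʳ-≤ (⁻¹-nonNegative (0<fromℕ (1 ℕ.+ i))) (fromℕ-mono (ℕ.n≤1+n (1 ℕ.+ i))) ⟩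
      fromℕ (2 ℕ.+ i) * fromℕ (1 ℕ.+ i) ⁻¹  ∎

  module _ (M : ℕ) (w : Carrier) where

    weight : ℕ → Carrier
    weight l = fromℕ 2 * fromℕ (suc (suc M)) - w * fromℕ (suc l)

    sum-weight*binomial : ∀ i → sum (suc M) (λ l → weight l * binomial l i) ≈
                          fromℕ (suc (suc M) ℕ.* suc M) * (binomial M i * moment w i)
    sum-weight*binomial i = begin-equality
      sum (suc M) (λ l → weight l * binomial l i)
        ≈⟨ sum-cong (suc M) (λ l → solve 4 (λ n w l b → (n :- w :* l) :* b := n :* b :+ :- w :* (l :* b))
            refl (fromℕ 2 * fromℕ (suc (suc M))) w (fromℕ (suc l)) (binomial l i)) ⟩
      sum (suc M) (λ l → fromℕ 2 * fromℕ (suc (suc M)) * binomial l i + - w * (fromℕ (suc l) * binomial l i))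
        ≈⟨ trans (sum-+ (suc M) _ _) (+-cong (sum-* (suc M) _ _) (sum-* (suc M) _ _)) ⟩
      fromℕ 2 * fromℕ (suc (suc M)) * sum (suc M) (λ l → binomial l i) +
      - w * sum (suc M) (λ l → fromℕ (suc l) * binomial l i)
        ≈⟨ +-cong
             (*-cong (*-congˡ (fromℕ-2+ M))
               (n*x≈y⇒x≈y*n⁻¹ (1 ℕ.+ i) (trans (*-congʳ (fromℕ-suc i)) (sum-binomial M i))))
             (*-congˡ (n*x≈y⇒x≈y*n⁻¹ (2 ℕ.+ i) (trans (*-congʳ (fromℕ-2+ i)) (sum-l*binomial M i)))) ⟩
      fromℕ 2 * (1# + (1# + m)) * ((1# + m) * b * fromℕ (1 ℕ.+ i) ⁻¹) +
      - w * ((1# + (1# + m)) * (1# + m) * b * fromℕ (2 ℕ.+ i) ⁻¹)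
        ≈⟨ solve 5 (λ m b w i j →
             # 2 :* (# 1 :+ (# 1 :+ m)) :* ((# 1 :+ m) :* b :* i) :+
             :- w :* ((# 1 :+ (# 1 :+ m)) :* (# 1 :+ m) :* b :* j)
             := (# 1 :+ (# 1 :+ m)) :* (# 1 :+ m) :* (b :* (# 2 :* i :- w :* j)))
                 refl m b w (fromℕ (1 ℕ.+ i) ⁻¹) (fromℕ (2 ℕ.+ i) ⁻¹) ⟩
      (1# + (1# + m)) * (1# + m) * (b * moment w i)
        ≈⟨ *-congʳ (*-cong (fromℕ-2+ M) (fromℕ-suc M)) ⟨
      fromℕ (suc (suc M)) * fromℕ (suc M) * (b * moment w i)
        ≈⟨ *-congʳ (fromℕ-* (suc (suc M)) (suc M)) ⟨
      fromℕ (suc (suc M) ℕ.* suc M) * (b * moment w i) ∎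
      where
      m b : Carrier
      m = fromℕ M
      b = binomial M i

    weight-nonNegative : w ≤ fromℕ 2 → ∀ l → l ℕ.< suc M → 0# ≤ weight l
    weight-nonNegative w≤2 l l<1+M = x≤y⇒0≤y-x $ begin
      w * fromℕ (suc l)                ≤⟨ *-monoʳ-≤ (0≤fromℕ (suc l)) w≤2 ⟩
      fromℕ 2 * fromℕ (suc l)          ≤⟨ *-monoˡ-≤ (0≤fromℕ 2) (fromℕ-mono (ℕ.m≤n⇒m≤1+n l<1+M)) ⟩
      fromℕ 2 * fromℕ (suc (suc M))    ∎

    sum-weight*power-≤ : ∀ {z} → 0# ≤ z → z ≤ 1# → w ≤ fromℕ 2 → ∀ r →
      sum (suc M) (λ l → weight l * (1# - z) ^ l) ≤
      fromℕ (suc (suc M) ℕ.* suc M) * sum (suc (r ℕ.* 2)) (λ i → (- z) ^ i * binomial M i * moment w i)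
    sum-weight*power-≤ {z} 0≤z z≤1 w≤2 r = begin
      sum (suc M) (λ l → weight l * (1# - z) ^ l)
        ≤⟨ sum-mono-≤ (suc M) (λ l l<1+M →
             *-monoˡ-≤ (weight-nonNegative w≤2 l l<1+M) (binomialSum-odd 0≤z z≤1 r l)) ⟩
      sum (suc M) (λ l → weight l * binomialSum k z l)
        ≈⟨ sum-cong (suc M) (λ l → sum-* k (weight l) _) ⟨
      sum (suc M) (λ l → sum k λ i → weight l * ((- z) ^ i * binomial l i))
        ≈⟨ sum-swap (suc M) k _ ⟩
      sum k (λ i → sum (suc M) λ l → weight l * ((- z) ^ i * binomial l i))
        ≈⟨ sum-cong k (λ i → begin-equality
             sum (suc M) (λ l → weight l * ((- z) ^ i * binomial l i))
               ≈⟨ sum-cong (suc M) (λ l → solve 3 (λ a p b → a :* (p :* b) := p :* (a :* b))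
                   refl (weight l) ((- z) ^ i) (binomial l i)) ⟩
             sum (suc M) (λ l → (- z) ^ i * (weight l * binomial l i))
               ≈⟨ sum-* (suc M) ((- z) ^ i) _ ⟩
             (- z) ^ i * sum (suc M) (λ l → weight l * binomial l i)
               ≈⟨ *-congˡ (sum-weight*binomial i) ⟩
             (- z) ^ i * (N * (binomial M i * moment w i))
               ≈⟨ solve 4 (λ p n b g → p :* (n :* (b :* g)) := n :* (p :* b :* g))
                   refl ((- z) ^ i) N (binomial M i) (moment w i) ⟩
             N * ((- z) ^ i * binomial M i * moment w i) ∎) ⟩
      sum k (λ i → N * ((- z) ^ i * binomial M i * moment w i))
        ≈⟨ sum-* k N _ ⟩
      N * sum k (λ i → (- z) ^ i * binomial M i * moment w i) ∎
      where
      k : ℕ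
      k = suc (r ℕ.* 2)
      N : Carrier
      N = fromℕ (suc (suc M) ℕ.* suc M)

  -1^n≈±1 : ∀ n → (- 1#) ^ n ≈ 1# ⊎ (- 1#) ^ n ≈ - 1#
  -1^n≈±1 zero = inj₁ refl
  -1^n≈±1 (suc n) with -1^n≈±1 n
  ... | inj₁ p = inj₂ (trans (*-congˡ p) (*-identityʳ _))
  ... | inj₂ p = inj₁ (trans (*-congˡ p) (solve 0 (:- # 1 :* :- # 1 := # 1) refl))

  [-x]^n≈[-1]^n*x^n : ∀ x n → (- x) ^ n ≈ (- 1#) ^ n * x ^ n
  [-x]^n≈[-1]^n*x^n x n = trans (^-congˡ n (solve 1 (λ x → :- x := :- # 1 :* x)
      refl x)) (^-distrib-* (- 1#) x n)

  module _ (a : Carrier) (0≤a : 0# ≤ a) where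

    expTerm : ℕ → Carrier
    expTerm zero    = 1#
    expTerm (suc i) = a * expTerm i * fromℕ (suc i) ⁻¹

    -- The coefficient of z in the error of expTerm i as an approximation of z ^ i * binomial M i.
    errorTerm : ℕ → Carrier
    errorTerm zero    = 0#
    errorTerm (suc i) = (a * errorTerm i + fromℕ i * expTerm i) * fromℕ (suc i) ⁻¹

    expTerm-nonNegative : ∀ i → 0# ≤ expTerm i
    expTerm-nonNegative zero    = 0≤1
    expTerm-nonNegative (suc i) =
      *-nonNegative (*-nonNegative 0≤a (expTerm-nonNegative i)) (⁻¹-nonNegative (0<fromℕ (suc i)))

    errorTerm-nonNegative : ∀ i → 0# ≤ errorTerm i
    errorTerm-nonNegative zero    = ≤.refl
    errorTerm-nonNegative (suc i) = *-nonNegative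
      (+-nonNegative (*-nonNegative 0≤a (errorTerm-nonNegative i))
                     (*-nonNegative (0≤fromℕ i) (expTerm-nonNegative i)))
      (⁻¹-nonNegative (0<fromℕ (suc i)))

    module _ {M : ℕ} {z : Carrier} (0≤z : 0# ≤ z) (Mz≈a : fromℕ M * z ≈ a) where

      scaledBinomial : ℕ → Carrier
      scaledBinomial i = z ^ i * binomial M i

      scaledBinomial-nonNegative : ∀ i → 0# ≤ scaledBinomial i
      scaledBinomial-nonNegative i = *-nonNegative (^-nonNegative 0≤z i) (0≤fromℕ _)

      scaledBinomial-suc : ∀ i → fromℕ (suc i) * scaledBinomial (suc i) ≈ (a - fromℕ i * z) * scaledBinomial i
      scaledBinomial-suc i = begin-equality
        fromℕ (suc i) * (z * z ^ i * binomial M (suc i))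
          ≈⟨ *-congʳ (fromℕ-suc i) ⟩
        (1# + fromℕ i) * (z * z ^ i * binomial M (suc i))
          ≈⟨ solve 4 (λ k z p b → k :* (z :* p :* b) := z :* p :* (k :* b))
              refl (1# + fromℕ i) z (z ^ i) (binomial M (suc i)) ⟩
        z * z ^ i * ((1# + fromℕ i) * binomial M (suc i))
          ≈⟨ *-congˡ (binomial-sucʳ M i) ⟩
        z * z ^ i * ((fromℕ M - fromℕ i) * binomial M i)
          ≈⟨ solve 5 (λ z p m i b → z :* p :* ((m :- i) :* b) := (m :* z :- i :* z) :* (p :* b))
              refl z (z ^ i) (fromℕ M) (fromℕ i) (binomial M i) ⟩
        (fromℕ M * z - fromℕ i * z) * scaledBinomial i
          ≈⟨ *-congʳ (+-congʳ Mz≈a) ⟩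
        (a - fromℕ i * z) * scaledBinomial i ∎

      scaledBinomial≤expTerm : ∀ i → scaledBinomial i ≤ expTerm i
      scaledBinomial≤expTerm zero    = ≤.reflexive (trans (*-congˡ (binomial-0 M)) (*-identityˡ 1#))
      scaledBinomial≤expTerm (suc i) = *-cancelˡ-≤ (0<fromℕ (suc i)) $ begin
        fromℕ (suc i) * scaledBinomial (suc i)   ≈⟨ scaledBinomial-suc i ⟩
        (a - fromℕ i * z) * scaledBinomial i     ≤⟨ *-monoʳ-≤ (scaledBinomial-nonNegative i) (begin
          a - fromℕ i * z
            ≤⟨ +-monoʳ-≤ a (-‿anti-≤ (*-nonNegative (0≤fromℕ i) 0≤z)) ⟩
          a - 0#                                   ≈⟨ solve 1 (λ a → a :- # 0 := a) refl a ⟩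
          a                                        ∎) ⟩
        a * scaledBinomial i                     ≤⟨ *-monoˡ-≤ 0≤a (scaledBinomial≤expTerm i) ⟩
        a * expTerm i                            ≈⟨ n*[x*n⁻¹]≈x (suc i) _ ⟨
        fromℕ (suc i) * expTerm (suc i)          ∎

      expTerm≤scaledBinomial : ∀ i → expTerm i ≤ scaledBinomial i + errorTerm i * z
      expTerm≤scaledBinomial zero    = ≤.reflexive $ sym $
        trans (+-congʳ (trans (*-congˡ (binomial-0 M)) (*-identityˡ 1#))) (solve 1 (λ z → # 1 :+ # 0 :* z
            := # 1) refl z)
      expTerm≤scaledBinomial (suc i) = *-cancelˡ-≤ (0<fromℕ (suc i)) $ begin
        fromℕ (suc i) * expTerm (suc i)
          ≈⟨ n*[x*n⁻¹]≈x (suc i) _ ⟩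
        a * expTerm i
          ≤⟨ *-monoˡ-≤ 0≤a (expTerm≤scaledBinomial i) ⟩
        a * (β + κ * z)
          ≈⟨ solve 6 (λ a b k i z e → a :* (b :+ k :* z)
              := (a :- i :* z) :* b :+ (a :* k :+ i :* b) :* z) refl a β κ (fromℕ i) z (expTerm i) ⟩
        (a - fromℕ i * z) * β + (a * κ + fromℕ i * β) * z
          ≤⟨ +-monoʳ-≤ _ (*-monoʳ-≤ 0≤z (+-monoʳ-≤ _ (*-monoˡ-≤ (0≤fromℕ i) (scaledBinomial≤expTerm i)))) ⟩
        (a - fromℕ i * z) * β + (a * κ + fromℕ i * expTerm i) * z
          ≈⟨ +-cong (scaledBinomial-suc i) (*-congʳ (n*[x*n⁻¹]≈x (suc i) _)) ⟨
        fromℕ (suc i) * scaledBinomial (suc i) + fromℕ (suc i) * errorTerm (suc i) * z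
          ≈⟨ solve 4 (λ n b k z → n :* b :+ n :* k :* z := n :* (b :+ k :* z))
              refl (fromℕ (suc i)) (scaledBinomial (suc i)) (errorTerm (suc i)) z ⟩
        fromℕ (suc i) * (scaledBinomial (suc i) + errorTerm (suc i) * z) ∎
        where
        β κ : Carrier
        β = scaledBinomial i
        κ = errorTerm i

      signed-≤ : ∀ i → (- z) ^ i * binomial M i ≤ (- 1#) ^ i * expTerm i + errorTerm i * z
      signed-≤ i = ≤.trans
        (≤.reflexive (trans (*-congʳ ([-x]^n≈[-1]^n*x^n z i)) (*-assoc _ _ _)))
        (bound (-1^n≈±1 i))
        where
        bound : (- 1#) ^ i ≈ 1# ⊎ (- 1#) ^ i ≈ - 1# →
                (- 1#) ^ i * scaledBinomial i ≤ (- 1#) ^ i * expTerm i + errorTerm i * z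
        bound (inj₁ p) = begin
          (- 1#) ^ i * scaledBinomial i              ≈⟨ trans (*-congʳ p) (*-identityˡ _) ⟩
          scaledBinomial i                           ≤⟨ scaledBinomial≤expTerm i ⟩
          expTerm i                                  ≈⟨ trans (*-congʳ p) (*-identityˡ _) ⟨
          (- 1#) ^ i * expTerm i                     ≈⟨ +-identityʳ _ ⟨
          (- 1#) ^ i * expTerm i + 0#
            ≤⟨ +-monoʳ-≤ _ (*-nonNegative (errorTerm-nonNegative i) 0≤z) ⟩
          (- 1#) ^ i * expTerm i + errorTerm i * z   ∎
        bound (inj₂ p) = begin
          (- 1#) ^ i * scaledBinomial i              ≈⟨ *-congʳ p ⟩
          - 1# * β
            ≈⟨ solve 2 (λ b k → :- # 1 :* b := :- (b :+ k) :+ k) refl β (errorTerm i * z) ⟩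
          - (β + errorTerm i * z) + errorTerm i * z
            ≤⟨ +-mono-≤ (-‿anti-≤ (expTerm≤scaledBinomial i)) ≤.refl ⟩
          - expTerm i + errorTerm i * z
            ≈⟨ +-congʳ (solve 1 (λ e → :- e := :- # 1 :* e) refl (expTerm i)) ⟩
          - 1# * expTerm i + errorTerm i * z         ≈⟨ +-congʳ (*-congʳ p) ⟨
          (- 1#) ^ i * expTerm i + errorTerm i * z   ∎
          where
          β : Carrier
          β = scaledBinomial i

      sum-signed-≤ : ∀ k {w} → w ≤ fromℕ 2 →
        sum k (λ i → (- z) ^ i * binomial M i * moment w i) ≤
        sum k (λ i → (- 1#) ^ i * expTerm i * moment w i) + z * sum k (λ i → errorTerm i * moment w i)
      sum-signed-≤ k {w} w≤2 = begin
        sum k (λ i → (- z) ^ i * binomial M i * moment w i)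
          ≤⟨ sum-mono-≤ k (λ i _ → *-monoʳ-≤ (moment-nonNegative w≤2 i) (signed-≤ i)) ⟩
        sum k (λ i → ((- 1#) ^ i * expTerm i + errorTerm i * z) * moment w i)
          ≈⟨ sum-cong k (λ i → solve 4 (λ s k z g → (s :+ k :* z) :* g := s :* g :+ z :* (k :* g))
              refl ((- 1#) ^ i * expTerm i) (errorTerm i) z (moment w i)) ⟩
        sum k (λ i → (- 1#) ^ i * expTerm i * moment w i + z * (errorTerm i * moment w i))
          ≈⟨ trans (sum-+ k _ _) (+-congˡ (sum-* k z _)) ⟩
        sum k (λ i → (- 1#) ^ i * expTerm i * moment w i) + z * sum k (λ i → errorTerm i * moment w i) ∎

  -- The polynomial inequality

  !*expTerm : ∀ {a} (0≤a : 0# ≤ a) i → fromℕ (i !) * expTerm a 0≤a i ≈ a ^ i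
  !*expTerm 0≤a zero = trans (*-congʳ fromℕ-1) (*-identityʳ 1#)
  !*expTerm {a} 0≤a (suc i) = begin-equality
    fromℕ (suc i ℕ.* i !) * (a * e * fromℕ (suc i) ⁻¹)
      ≈⟨ *-congʳ (fromℕ-* (suc i) (i !)) ⟩
    fromℕ (suc i) * fromℕ (i !) * (a * e * fromℕ (suc i) ⁻¹)
      ≈⟨ solve 5 (λ n f a e j → n :* f :* (a :* e :* j) := a :* (f :* e) :* (n :* j))
          refl (fromℕ (suc i)) (fromℕ (i !)) a e (fromℕ (suc i) ⁻¹) ⟩
    a * (fromℕ (i !) * e) * (fromℕ (suc i) * fromℕ (suc i) ⁻¹)
      ≈⟨ *-cong (*-congˡ (!*expTerm 0≤a i)) (⁻¹-inverseʳ _ (fromℕ≉0 (suc i))) ⟩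
    a * a ^ i * 1#
      ≈⟨ *-identityʳ _ ⟩
    a ^ suc i ∎
    where
    e : Carrier
    e = expTerm a 0≤a i

  moment-cleared : ∀ w i → fromℕ (suc i) * fromℕ (suc (suc i)) * moment w i ≈
                   fromℕ 2 * fromℕ (suc (suc i)) - w * fromℕ (suc i)
  moment-cleared w i = begin-equality
    n₁ * n₂ * moment w i
      ≈⟨ solve 5 (λ n₁ n₂ w i j → n₁ :* n₂ :* (# 2 :* i :- w :* j)
          := # 2 :* n₂ :* (n₁ :* i) :- w :* n₁ :* (n₂ :* j)) refl n₁ n₂ w (n₁ ⁻¹) (n₂ ⁻¹) ⟩
    fromℕ 2 * n₂ * (n₁ * n₁ ⁻¹) - w * n₁ * (n₂ * n₂ ⁻¹)
      ≈⟨ +-cong (*-congˡ (⁻¹-inverseʳ _ (fromℕ≉0 (suc i))))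
                (-‿cong (*-congˡ (⁻¹-inverseʳ _ (fromℕ≉0 (suc (suc i)))))) ⟩
    fromℕ 2 * n₂ * 1# - w * n₁ * 1#
      ≈⟨ +-cong (*-identityʳ _) (-‿cong (*-identityʳ _)) ⟩
    fromℕ 2 * n₂ - w * n₁ ∎
    where
    n₁ n₂ : Carrier
    n₁ = fromℕ (suc i)
    n₂ = fromℕ (suc (suc i))

  taylorTerm : ∀ {a} → 0# ≤ a → Carrier → ℕ → Carrier
  taylorTerm {a} 0≤a w i = (- 1#) ^ i * expTerm a 0≤a i * moment w i

  module _ {t : Carrier} (0≤t : 0# ≤ t) (t≤1 : t ≤ 1#) where

    private
      u s : Carrier
      u = 11 / 6
      s = 1# - t

      0≤s : 0# ≤ s
      0≤s = x≤y⇒0≤y-x t≤1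

      0≤us : 0# ≤ u * s
      0≤us = *-nonNegative (/-nonNegative 11 6) 0≤s

      τ : ℕ → Carrier
      τ = taylorTerm 0≤us (u * t)

      r : ℕ → Carrier
      r i = fromℕ 11 ^ (1 ℕ.+ i) * ((- 1#) ^ i * s ^ i) *
            (fromℕ (12 ℕ.* (2 ℕ.+ i)) - fromℕ (11 ℕ.* (1 ℕ.+ i)) * t)


    taylorTerm-cleared : ∀ i →
      fromℕ 6 ^ (2 ℕ.+ i) * fromℕ ((2 ℕ.+ i) !) * (u * τ i) ≈ r i
    taylorTerm-cleared i = begin-equality
      fromℕ 6 ^ (2 ℕ.+ i) * fromℕ ((2 ℕ.+ i) !) * (u * (σ * e * γ))
        ≈⟨ *-congʳ (*-congˡ (trans (fromℕ-* (2 ℕ.+ i) ((1 ℕ.+ i) !)) (*-congˡ (fromℕ-* (1 ℕ.+ i) (i !))))) ⟩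
      fromℕ 6 * (fromℕ 6 * p) * (n₂ * (n₁ * f)) * (u * (σ * e * γ))
        ≈⟨ solve 8 (λ p n₂ n₁ f u σ e γ → # 6 :* (# 6 :* p) :* (n₂ :* (n₁ :* f)) :* (u :* (σ :* e :* γ))
            := # 6 :* (# 6 :* u) :* σ :* (p :* (f :* e)) :* (n₁ :* n₂ :* γ)) refl p n₂ n₁ f u σ e γ ⟩
      fromℕ 6 * (fromℕ 6 * u) * σ * (p * (f * e)) * (n₁ * n₂ * γ)
        ≈⟨ *-cong (*-cong (*-congʳ (*-congˡ (n*[m/n]≈m 11 6))) power) (moment-cleared (u * t) i) ⟩
      fromℕ 6 * fromℕ 11 * σ * (fromℕ 11 ^ i * s ^ i) * (fromℕ 2 * n₂ - u * t * n₁)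
        ≈⟨ solve 7 (λ σ p s n₂ u t n₁ → # 6 :* # 11 :* σ :* (p :* s) :* (# 2 :* n₂ :- u :* t :* n₁)
            := # 11 :* p :* (σ :* s) :* (# 12 :* n₂ :- # 6 :* u :* t :* n₁))
                refl σ (fromℕ 11 ^ i) (s ^ i) n₂ u t n₁ ⟩
      fromℕ 11 * fromℕ 11 ^ i * (σ * s ^ i) * (fromℕ 12 * n₂ - fromℕ 6 * u * t * n₁)
        ≈⟨ *-congˡ (+-congˡ (-‿cong (*-congʳ (*-congʳ (n*[m/n]≈m 11 6))))) ⟩
      fromℕ 11 * fromℕ 11 ^ i * (σ * s ^ i) * (fromℕ 12 * n₂ - fromℕ 11 * t * n₁)
        ≈⟨ *-congˡ (+-congˡ (-‿cong (solve 2 (λ t n₁ → # 11 :* t :* n₁ := # 11 :* n₁ :* t) refl t n₁))) ⟩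
      fromℕ 11 * fromℕ 11 ^ i * (σ * s ^ i) * (fromℕ 12 * n₂ - fromℕ 11 * n₁ * t)
        ≈⟨ *-congˡ (+-cong (fromℕ-* 12 (2 ℕ.+ i)) (-‿cong (*-congʳ (fromℕ-* 11 (1 ℕ.+ i))))) ⟨
      fromℕ 11 ^ (1 ℕ.+ i) * (σ * s ^ i) * (fromℕ (12 ℕ.* (2 ℕ.+ i)) - fromℕ (11 ℕ.* (1 ℕ.+ i)) * t) ∎
      where
      p n₂ n₁ f σ e γ : Carrier
      p = fromℕ 6 ^ i
      n₂ = fromℕ (2 ℕ.+ i)
      n₁ = fromℕ (1 ℕ.+ i)
      f = fromℕ (i !)
      σ = (- 1#) ^ i
      e = expTerm (u * s) 0≤us i
      γ = moment (u * t) i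
      power : p * (f * e) ≈ fromℕ 11 ^ i * s ^ i
      power = begin-equality
        p * (f * e)            ≈⟨ *-congˡ (!*expTerm 0≤us i) ⟩
        fromℕ 6 ^ i * (u * s) ^ i ≈⟨ ^-distrib-* (fromℕ 6) (u * s) i ⟨
        (fromℕ 6 * (u * s)) ^ i   ≈⟨ ^-congˡ i (trans (sym (*-assoc _ _ _)) (*-congʳ (n*[m/n]≈m 11 6))) ⟩
        (fromℕ 11 * s) ^ i        ≈⟨ ^-distrib-* (fromℕ 11) s i ⟩
        fromℕ 11 ^ i * s ^ i      ∎

    private
      -- D = 6 ^ 8 * 8 ! is the common denominator of the seven terms, and R is L times
      -- 2014096 D - 10⁶ P.  The maximum of P is attained near t = 788 / 939; dividing by h²
      -- leaves a quotient with nonnegative coefficients in t and s, and a linear remainder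
      -- that is nonnegative at t = 0 and at t = 1.
      D L P h R : Carrier
      D = fromℕ 67722117120
      L = fromℕ 214554630137518896993
      P = fromℕ 940584960 * r 0 + fromℕ 52254720 * r 1 + fromℕ 2177280 * r 2 + fromℕ 72576 * r 3
        + fromℕ 2016 * r 4 + fromℕ 48 * r 5 + r 6
      h = fromℕ 939 * t - fromℕ 788
      R = fromℕ 74748541336115543082912632975360 * s
        + fromℕ 2747837186087205408236991975360 * t
        + h * h * (fromℕ 7689407765197520926516414000000
          + fromℕ 6463106756729302651519361000000 * t
          + fromℕ 1373643541539232944446796000000 * (t * t)
          + t * (t * t) * (fromℕ 1942155081942297373193823000000
            + fromℕ 667496644240303482324786000000 * s
            + fromℕ 365128916071560037846911000000 * (t * t)))

      0≤R : 0# ≤ R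
      0≤R = +-nonNegative
        (+-nonNegative (*-nonNegative (0≤fromℕ _) 0≤s) (*-nonNegative (0≤fromℕ _) 0≤t))
        (*-nonNegative (*-selfNonNegative h) (+-nonNegative
          (+-nonNegative (+-nonNegative (0≤fromℕ _) (*-nonNegative (0≤fromℕ _) 0≤t)) (*-nonNegative (0≤fromℕ _) 0≤t²))
          (*-nonNegative (*-nonNegative 0≤t 0≤t²) (+-nonNegative
            (+-nonNegative (0≤fromℕ _) (*-nonNegative (0≤fromℕ _) 0≤s)) (*-nonNegative (0≤fromℕ _) 0≤t²)))))
        where
        0≤t² : 0# ≤ t * t
        0≤t² = *-selfNonNegative t

      certificate : L * (fromℕ 1000000 * P) + R ≈ L * (fromℕ 2014096 * D)
      certificate = solve 1 (λ t →
        let s = # 1 :- t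
            r = λ i → # 11 :^ (1 ℕ.+ i) :* ((:- # 1) :^ i :* s :^ i) :*
                      (# (12 ℕ.* (2 ℕ.+ i)) :- # (11 ℕ.* (1 ℕ.+ i)) :* t)
            P = # 940584960 :* r 0 :+ # 52254720 :* r 1 :+ # 2177280 :* r 2 :+ # 72576 :* r 3
              :+ # 2016 :* r 4 :+ # 48 :* r 5 :+ r 6
            h = # 939 :* t :- # 788
            R = # 74748541336115543082912632975360 :* s
              :+ # 2747837186087205408236991975360 :* t
              :+ h :* h :* (# 7689407765197520926516414000000
                :+ # 6463106756729302651519361000000 :* t
                :+ # 1373643541539232944446796000000 :* (t :* t)
                :+ t :* (t :* t) :* (# 1942155081942297373193823000000
                  :+ # 667496644240303482324786000000 :* s
                  :+ # 365128916071560037846911000000 :* (t :* t)))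
        in # 214554630137518896993 :* (# 1000000 :* P) :+ R
            := # 214554630137518896993 :* (# 2014096 :* # 67722117120)) refl t

      collected : D * (u * sum 7 τ) ≈ P
      collected = begin-equality
        D * (u * sum 7 τ)
          ≈⟨ solve 8 (λ u τ₀ τ₁ τ₂ τ₃ τ₄ τ₅ τ₆ →
               let cleared = λ i τ → # 6 :^ (2 ℕ.+ i) :* # ((2 ℕ.+ i) !) :* (u :* τ) in
               # 67722117120 :* (u :* (# 0 :+ τ₀ :+ τ₁ :+ τ₂ :+ τ₃ :+ τ₄ :+ τ₅ :+ τ₆)) :=
               # 940584960 :* cleared 0 τ₀ :+ # 52254720 :* cleared 1 τ₁ :+ # 2177280 :* cleared 2 τ₂
               :+ # 72576 :* cleared 3 τ₃ :+ # 2016 :* cleared 4 τ₄ :+ # 48 :* cleared 5 τ₅ :+ cleared 6 τ₆)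
               refl u (τ 0) (τ 1) (τ 2) (τ 3) (τ 4) (τ 5) (τ 6) ⟩
        fromℕ 940584960 * cleared 0 + fromℕ 52254720 * cleared 1 + fromℕ 2177280 * cleared 2
        + fromℕ 72576 * cleared 3 + fromℕ 2016 * cleared 4 + fromℕ 48 * cleared 5 + cleared 6
          ≈⟨ +-cong (+-cong (+-cong (+-cong (+-cong (+-cong
               (*-congˡ (taylorTerm-cleared 0))
               (*-congˡ (taylorTerm-cleared 1)))
               (*-congˡ (taylorTerm-cleared 2)))
               (*-congˡ (taylorTerm-cleared 3)))
               (*-congˡ (taylorTerm-cleared 4)))
               (*-congˡ (taylorTerm-cleared 5)))
               (taylorTerm-cleared 6) ⟩
        P ∎
        where
        cleared : ℕ → Carrier
        cleared i = fromℕ 6 ^ (2 ℕ.+ i) * fromℕ ((2 ℕ.+ i) !) * (u * τ i)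

    taylor-≤ : u * sum 7 τ ≤ 2014096 / 1000000
    taylor-≤ = *-cancelˡ-≤ (0<fromℕ 67722117120) $ *-cancelˡ-≤ (0<fromℕ 1000000) $
      *-cancelˡ-≤ (0<fromℕ 214554630137518896993) $ begin
      L * (fromℕ 1000000 * (D * (u * sum 7 τ)))
        ≈⟨ *-congˡ (*-congˡ collected) ⟩
      L * (fromℕ 1000000 * P)                   ≈⟨ +-identityʳ _ ⟨
      L * (fromℕ 1000000 * P) + 0#              ≤⟨ +-monoʳ-≤ _ 0≤R ⟩
      L * (fromℕ 1000000 * P) + R               ≈⟨ certificate ⟩
      L * (fromℕ 2014096 * D)
        ≈⟨ *-congˡ (*-congʳ (n*[m/n]≈m 2014096 1000000)) ⟨
      L * (fromℕ 1000000 * (2014096 / 1000000) * D)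
        ≈⟨ *-congˡ (trans (*-assoc _ _ _) (*-congˡ (*-comm _ _))) ⟩
      L * (fromℕ 1000000 * (D * (2014096 / 1000000))) ∎

  module _ {x₁ x₂ : Carrier} (0≤x₁ : 0# ≤ x₁) (0≤x₂ : 0# ≤ x₂) (x₁+x₂≤1 : x₁ + x₂ ≤ 1#)
           (x₁≤6/11 : x₁ ≤ 6 / 11) (x₂≤6/11 : x₂ ≤ 6 / 11) where

    private
      u t : Carrier
      u = 11 / 6
      t = x₁ + x₂

      u≤2 : u ≤ fromℕ 2
      u≤2 = *-cancelˡ-≤ (0<fromℕ 6) $ begin
        fromℕ 6 * u          ≈⟨ n*[m/n]≈m 11 6 ⟩
        fromℕ 11             ≤⟨ fromℕ-mono (ℕ.n≤1+n 11) ⟩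
        fromℕ 12             ≈⟨ fromℕ-* 6 2 ⟩
        fromℕ 6 * fromℕ 2    ∎

      u*≤2 : ∀ {y} → y ≤ 1# → u * y ≤ fromℕ 2
      u*≤2 {y} y≤1 = begin
        u * y    ≤⟨ *-monoˡ-≤ (/-nonNegative 11 6) y≤1 ⟩
        u * 1#   ≈⟨ *-identityʳ u ⟩
        u        ≤⟨ u≤2 ⟩
        fromℕ 2  ∎

      0≤t : 0# ≤ t
      0≤t = +-nonNegative 0≤x₁ 0≤x₂

      1-t≤1 : 1# - t ≤ 1#
      1-t≤1 = ≤.trans (+-monoʳ-≤ 1# (-‿anti-≤ 0≤t)) (≤.reflexive (solve 0 (# 1 :- # 0 := # 1) refl))

      0≤a : 0# ≤ u * (1# - t)
      0≤a = *-nonNegative (/-nonNegative 11 6) (x≤y⇒0≤y-x x₁+x₂≤1)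

    errorFactor : Carrier
    errorFactor = u * (1# - t) * (u * sum 7 (λ i → errorTerm _ 0≤a i * moment (u * t) i))

    module _ (m : ℕ) (1≤m : 1 ℕ.≤ m) where

      private
        n′ : ℕ
        n′ = suc (suc m)

        c z W₁ W₂ : Carrier
        c  = C-remaining m x₁ x₂
        z  = u * c
        W₁ = weightedSum n′ (1# - F c) (1# - F x₁)
        W₂ = weightedSum n′ (1# - F c) (1# - F x₂)

        N : Carrier
        N = fromℕ (suc n′ ℕ.* n′)

        0≤z : 0# ≤ z
        0≤z = *-nonNegative (/-nonNegative 11 6) (C-remaining-nonNegative m x₁+x₂≤1)

        Mz≈a : fromℕ (suc m) * z ≈ u * (1# - t)
        Mz≈a = begin-equality
          fromℕ (suc m) * (u * ((1# - x₁ - x₂) * fromℕ (suc m) ⁻¹))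
            ≈⟨ solve 5 (λ m u x y i → m :* (u :* ((# 1 :- x :- y) :* i))
                := u :* (# 1 :- (x :+ y)) :* (m :* i)) refl (fromℕ (suc m)) u x₁ x₂ (fromℕ (suc m) ⁻¹) ⟩
          u * (1# - t) * (fromℕ (suc m) * fromℕ (suc m) ⁻¹)
            ≈⟨ *-congˡ (⁻¹-inverseʳ _ (fromℕ≉0 (suc m))) ⟩
          u * (1# - t) * 1#
            ≈⟨ *-identityʳ _ ⟩
          u * (1# - t) ∎

        z≤1 : z ≤ 1#
        z≤1 = *-cancelˡ-≤ (0<fromℕ (suc m)) $ begin
          fromℕ (suc m) * z   ≈⟨ Mz≈a ⟩
          u * (1# - t)        ≤⟨ u*≤2 1-t≤1 ⟩
          fromℕ 2             ≤⟨ fromℕ-mono (ℕ.s≤s 1≤m) ⟩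
          fromℕ (suc m)       ≈⟨ *-identityʳ _ ⟨
          fromℕ (suc m) * 1#  ∎

        q≈1-z : 1# - F c ≈ 1# - z
        q≈1-z = +-congˡ (-‿cong (F-linear z≤1))

      weightedSum-small : W₂ + W₁ ≈ sum n′ (λ l → weight (suc m) (u * t) l * (1# - z) ^ l)
      weightedSum-small = trans (sym (sum-+ n′ _ _)) $ sum-cong n′ λ l →
        let p = (1# - F c) ^ l ; k = fromℕ n′ - fromℕ l in begin-equality
        (fromℕ (suc l) * (1# - F x₂) + k) * p + (fromℕ (suc l) * (1# - F x₁) + k) * p
          ≈⟨ +-cong (*-congʳ (+-congʳ (*-cong (fromℕ-suc l) (+-congˡ (-‿cong (F-small x₂≤6/11))))))
                    (*-congʳ (+-congʳ (*-cong (fromℕ-suc l) (+-congˡ (-‿cong (F-small x₁≤6/11)))))) ⟩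
        ((1# + fromℕ l) * (1# - u * x₂) + k) * p + ((1# + fromℕ l) * (1# - u * x₁) + k) * p
          ≈⟨ solve 6 (λ l n u x y p →
               ((# 1 :+ l) :* (# 1 :- u :* y) :+ (n :- l)) :* p :+ ((# 1 :+ l) :* (# 1 :- u :* x) :+ (n :- l)) :* p
               := (# 2 :* (# 1 :+ n) :- u :* (x :+ y) :* (# 1 :+ l)) :* p)
               refl (fromℕ l) (fromℕ n′) u x₁ x₂ p ⟩
        (fromℕ 2 * (1# + fromℕ n′) - u * t * (1# + fromℕ l)) * p
          ≈⟨ *-cong (+-cong (*-congˡ (fromℕ-suc n′)) (-‿cong (*-congˡ (fromℕ-suc l)))) (^-congˡ l (sym q≈1-z)) ⟨
        weight (suc m) (u * t) l * (1# - z) ^ l ∎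

      C-small-≤ : C m x₁ x₂ ≤ u * sum 7 (λ i → (- z) ^ i * binomial (suc m) i * moment (u * t) i)
      C-small-≤ = *-cancelˡ-≤ (0<fromℕ (suc n′ ℕ.* n′)) $ begin
        N * C m x₁ x₂
          ≈⟨ C-formula m x₁ x₂ ⟩
        F′ x₁ * W₂ + F′ x₂ * W₁
          ≡⟨ ≡.cong₂ (λ f g → f * W₂ + g * W₁) (F′-small x₁≤6/11) (F′-small x₂≤6/11) ⟩
        u * W₂ + u * W₁
          ≈⟨ trans (sym (distribˡ u _ _)) (*-congˡ weightedSum-small) ⟩
        u * sum n′ (λ l → weight (suc m) (u * t) l * (1# - z) ^ l)
          ≤⟨ *-monoˡ-≤ (/-nonNegative 11 6) (sum-weight*power-≤ (suc m) (u * t) 0≤z z≤1 (u*≤2 x₁+x₂≤1) 3) ⟩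
        u * (N * sum 7 (λ i → (- z) ^ i * binomial (suc m) i * moment (u * t) i))
          ≈⟨ solve 3 (λ u n s → u :* (n :* s) := n :* (u :* s)) refl u N _ ⟩
        N * (u * sum 7 (λ i → (- z) ^ i * binomial (suc m) i * moment (u * t) i)) ∎

      C-small-error : fromℕ (suc m) * (C m x₁ x₂ - 2014096 / 1000000) ≤ errorFactor
      C-small-error = begin
        fromℕ (suc m) * (C m x₁ x₂ - b)
          ≤⟨ *-monoˡ-≤ (0≤fromℕ (suc m)) (+-mono-≤ (≤.trans C-small-≤ (*-monoˡ-≤ (/-nonNegative 11 6)
               (sum-signed-≤ _ 0≤a {suc m} 0≤z Mz≈a 7 (u*≤2 x₁+x₂≤1)))) ≤.refl) ⟩
        fromℕ (suc m) * (u * (T + z * E) - b)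
          ≈⟨ *-congˡ (solve 5 (λ u T z E b → u :* (T :+ z :* E) :- b := u :* T :+ (z :* (u :* E) :- b))
              refl u T z E b) ⟩
        fromℕ (suc m) * (u * T + (z * (u * E) - b))
          ≤⟨ *-monoˡ-≤ (0≤fromℕ (suc m)) (+-mono-≤ (taylor-≤ 0≤t x₁+x₂≤1) ≤.refl) ⟩
        fromℕ (suc m) * (b + (z * (u * E) - b))
          ≈⟨ solve 4 (λ m b z E → m :* (b :+ (z :* E :- b)) := m :* z :* E)
              refl (fromℕ (suc m)) b z (u * E) ⟩
        fromℕ (suc m) * z * (u * E)
          ≈⟨ *-congʳ Mz≈a ⟩
        errorFactor ∎
        where
        b T E : Carrier
        b = 2014096 / 1000000
        T = sum 7 (λ i → (- 1#) ^ i * expTerm _ 0≤a i * moment (u * t) i)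
        E = sum 7 (λ i → errorTerm _ 0≤a i * moment (u * t) i)

lemma6p6 : (ℝ : CompleteOrderedField) →
    let open CompleteOrderedField ℝ
        open Simplex ℝ in
    ∀ x₁ x₂ → 0# ≤ x₁ → 0# ≤ x₂ → x₁ + x₂ ≤ 1# →
    ∀ C∞ → (λ m → C m x₁ x₂) ⟶ C∞ →
    C∞ ≤ (if does ((x₁ ≤? 6 / 11) ×-dec (x₂ ≤? 6 / 11)) then 2014096 / 1000000 else 11 / 12)
lemma6p6 ℝ x₁ x₂ 0≤x₁ 0≤x₂ x₁+x₂≤1 C∞ C⟶C∞ =
  ≤-if ((x₁ ≤? 6 / 11) ×-dec (x₂ ≤? 6 / 11)) small (not-both (x₁ ≤? 6 / 11))
  where
  open CompleteOrderedField ℝ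
  open Simplex ℝ
  open OrderedField ℝ
  open Bounds ℝ

  large : (∀ m → C m x₁ x₂ ≤ 11 / 12) → C∞ ≤ 11 / 12
  large C≤11/12 = ⟶-upperBound C⟶C∞ λ m _ → begin
    fromℕ (suc m) * (C m x₁ x₂ - 11 / 12)
      ≤⟨ *-monoˡ-≤ (0≤fromℕ (suc m)) (+-mono-≤ (C≤11/12 m) ≤.refl) ⟩
    fromℕ (suc m) * (11 / 12 - 11 / 12)
      ≈⟨ solve 2 (λ m b → m :* (b :- b) := # 0) refl (fromℕ (suc m)) (11 / 12) ⟩
    0#                                      ∎

  small : x₁ ≤ 6 / 11 × x₂ ≤ 6 / 11 → C∞ ≤ 2014096 / 1000000
  small (x₁≤6/11 , x₂≤6/11) = ⟶-upperBound C⟶C∞ (C-small-error 0≤x₁ 0≤x₂ x₁+x₂≤1 x₁≤6/11 x₂≤6/11)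

  not-both : Dec (x₁ ≤ 6 / 11) → ¬ (x₁ ≤ 6 / 11 × x₂ ≤ 6 / 11) → C∞ ≤ 11 / 12
  not-both (yes x₁≤6/11) ¬both = large λ m → C-large₂ m x₁+x₂≤1 λ x₂≤6/11 → ¬both (x₁≤6/11 , x₂≤6/11)
  not-both (no  x₁≰6/11) ¬both = large λ m → C-large₁ m x₁+x₂≤1 x₁≰6/11

  ≤-if : ∀ {P : Set} (P? : Dec P) {a b} → (P → C∞ ≤ a) → (¬ P → C∞ ≤ b) → C∞ ≤ (if does P? then a else b)
  ≤-if (yes p) C≤a C≤b = C≤a p
  ≤-if (no ¬p) C≤a C≤b = C≤b ¬p
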